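{- Let $U=U_1\times\cdots\times U_m$ be a Cartesian product of nonempty finite sets. If $G=(V,E)$ is a quasi-median graph isometrically embedded into the Hamming graph $H(U)$, then $V$ (identified with its image in $U$) is an ample subset of $U$.
   Context: Graphs are finite, simple and connected; $d$ is the graph distance and $[u,v]=\{x: d(u,x)+d(x,v)=d(u,v)\}$. A set of vertices is convex if it contains $[u,v]$ for all its $u,v$. Three vertices $v_1,v_2,v_3$ form a metric triangle $v_1v_2v_3$ if $[v_i,v_j]\cap[v_i,v_k]=\{v_i\}$ for $\{i,j,k\}=\{1,2,3\}$; it is equilateral if $d(v_1,v_2)=d(v_2,v_3)=d(v_3,v_1)$. A quasi-median of a triplet $u_1,u_2,u_3$ is a metric triangle $v_1v_2v_3$ with $d(u_i,u_j)=d(u_i,v_i)+d(v_i,v_j)+d(v_j,u_j)$ for all $i\neq j$. A graph $G$ is quasi-median if: each triplet of vertices has a unique quasi-median and it is an equilateral metric triangle; $G$ contains no induced kite $K_4^-$ (two triangles glued along an edge); and the convex hull of any isometric 6-cycle is a 3-cube. The Hamming graph $H(U)$ has vertex set $U$, two tuples being adjacent iff they differ in exactly one coordinate. An isometric embedding is a distance-preserving map of vertex sets. A generalized partition of $U$ is a tuple $\Lambda=(\alpha_1,\dots,\alpha_m)$ with $\alpha_i$ a partition of $U_i$ into nonempty blocks; it defines a partition of $U$ into the boxes $P^1\times\cdots\times P^m$, $P^i\in\alpha_i$, and the minor-subproduct $M(\Lambda)=M_1\times\cdots\times M_m$, where $M_i$ is the set of blocks of $\alpha_i$. $M(\Lambda)$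 is shattered by $S\subseteq U$ if $S$ meets every box of the box-partition. A copy of $M(\Lambda)$ is a set $W_1\times\cdots\times W_m$ where $W_i$ consists of exactly one element from each block of $\alpha_i$. $M(\Lambda)$ is strongly shattered by $S$ if $S$ contains a copy of it. $S$ is ample if every minor-subproduct of $U$ shattered by $S$ is strongly shattered by $S$. -}

module Defs where

open import Data.Empty using (⊥-elim)
open import Data.Fin using (Fin; zero; suc; toℕ)
open import Data.Fin.Patterns using (0F; 1F; 2F; 3F; 4F; 5F)
open import Data.Fin.Properties as Fin using (any?; all?; *↔×)
open import Data.Fin.Subset using (Subset; Nonempty) renaming (_∈_ to _∈ₛ_)
open import Data.Nat using (ℕ; zero; suc; _+_; _*_; _≤_; z≤n; s≤s)
open import Data.Nat.DivMod using (_%_)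
import Data.Nat.Properties as ℕ
open import Data.Product using (∃; ∃!; _×_; _,_; proj₁; proj₂)
open import Data.Product.Function.NonDependent.Propositional using (_×-↔_)
open import Data.Sum using (_⊎_; inj₁; inj₂; swap)
open import Data.Vec using (Vec; []; _∷_; lookup)
open import Data.Vec.Functional using (Vector)
open import Data.Vec.Relation.Unary.All using (All; []; _∷_)
open import Data.Vec.Relation.Unary.All.Properties using (lookup⁺)
open import Function using (_∘_; _↔_; _⇔_; Injective; Inverse; mk↔ₛ′)
open import Function.Construct.Composition using (_↔-∘_)
open import Function.Construct.Identity using (↔-id)
open import Function.Construct.Symmetry using (↔-sym)
open import Function.Properties.Inverse using (Inverse⇒Injection)
open import Level using (0ℓ)
open import Relation.Binary using (Rel; Symmetric; Irreflexive; Decidable; DecidableEquality)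
open import Relation.Binary.PropositionalEquality using (_≡_; _≢_; _≗_; refl; sym; cong; subst; ≢-sym)
open import Relation.Nullary using (¬_; Dec; yes; no)
open import Relation.Nullary.Decidable using (map′; via-injection; ¬?; _×-dec_; _⊎-dec_; _→-dec_)
open import Relation.Unary using (Pred; _∈_; _⊆_; _∩_; _≐_; ｛_｝) renaming (Decidable to Decidable₁)

Finite : Set → Set
Finite A = ∃ λ n → A ↔ Fin n

finite-≟ : ∀ {A} → Finite A → DecidableEquality A
finite-≟ (_ , f) = via-injection (Inverse⇒Injection f) Fin._≟_

finite-any? : ∀ {A} → Finite A → {P : Pred A 0ℓ} → Decidable₁ P → Dec (∃ P)
finite-any? (_ , f) {P} P? =
  map′ (λ (i , p) → from i , p)
       (λ (a , p) → to a , subst P (sym (strictlyInverseʳ a)) p)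
       (any? (P? ∘ from))
  where open Inverse f

least : ∀ {P : Pred ℕ 0ℓ} → Decidable₁ P → ∀ n → P n →
        ∃ λ k → P k × (∀ {j} → P j → k ≤ j)
least P? zero p = zero , p , λ _ → z≤n
least {P} P? (suc n) p with P? zero
... | yes p₀ = zero , p₀ , λ _ → z≤n
... | no ¬p₀ with least (P? ∘ suc) n p
...   | k , pₖ , k≤ = suc k , pₖ , minimal
  where
  minimal : ∀ {j} → P j → suc k ≤ j
  minimal {zero}  q = ⊥-elim (¬p₀ q)
  minimal {suc j} q = s≤s (k≤ q)

infixr 5 _∷_

data Walk {V : Set} (_~_ : Rel V 0ℓ) : ℕ → V → V → Set where
  []  : ∀ {u} → Walk _~_ 0 u u
  _∷_ : ∀ {k u v w} → u ~ v → Walk _~_ k v w → Walk _~_ (suc k) u w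

walk? : ∀ {V} {_~_ : Rel V 0ℓ} → Finite V → Decidable _~_ →
        ∀ k → Decidable (Walk _~_ k)
walk? fin ~? zero u v =
  map′ (λ { refl → [] }) (λ { [] → refl }) (finite-≟ fin u v)
walk? fin ~? (suc k) u w =
  map′ (λ (_ , e , p) → e ∷ p) (λ { (e ∷ p) → _ , e , p })
       (finite-any? fin (λ v → ~? u v ×-dec walk? fin ~? k v w))

walk-from-root : ∀ {V} {_~_ : Rel V 0ℓ} → Symmetric _~_ → ∀ {r} →
                 (∀ v → ∃ λ k → Walk _~_ k r v) → ∀ u v → ∃ λ k → Walk _~_ k u v
walk-from-root {_~_ = _~_} ~-sym reach u v = extend (proj₂ (reach u)) (reach v)
  where
  extend : ∀ {k r u v} → Walk _~_ k r u → (∃ λ l → Walk _~_ l r v) → ∃ λ l → Walk _~_ l u v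
  extend []      q       = q
  extend (e ∷ p) (l , q) = extend p (suc l , ~-sym e ∷ q)

record Graph : Set₁ where
  infix 4 _~_
  field
    Vertex    : Set
    finite    : Finite Vertex
    _~_       : Rel Vertex 0ℓ
    ~-dec     : Decidable _~_
    ~-sym     : Symmetric _~_
    ~-irrefl  : Irreflexive _≡_ _~_
    connected : ∀ u v → ∃ λ k → Walk _~_ k u v

  shortest : ∀ u v → ∃ λ k → Walk _~_ k u v × (∀ {j} → Walk _~_ j u v → k ≤ j)
  shortest u v =
    least (λ k → walk? finite ~-dec k u v) (proj₁ (connected u v)) (proj₂ (connected u v))

  d : Vertex → Vertex → ℕ
  d u v = proj₁ (shortest u v)

  [_,_] : Vertex → Vertex → Pred Vertex 0ℓ
  [ u , v ] x = d u x + d x v ≡ d u v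

  Convex : Pred Vertex 0ℓ → Set
  Convex P = ∀ {u v} → u ∈ P → v ∈ P → [ u , v ] ⊆ P

  ConvexHull : Pred Vertex 0ℓ → Pred Vertex _
  ConvexHull A x = ∀ (P : Pred Vertex 0ℓ) → Convex P → A ⊆ P → x ∈ P

  MetricTriangle : Vector Vertex 3 → Set
  MetricTriangle v = ∀ i j k → i ≢ j → i ≢ k → j ≢ k →
    ([ v i , v j ] ∩ [ v i , v k ]) ≐ ｛ v i ｝

  Equilateral : Vector Vertex 3 → Set
  Equilateral v = d (v 0F) (v 1F) ≡ d (v 1F) (v 2F)
                × d (v 1F) (v 2F) ≡ d (v 2F) (v 0F)

  QuasiMedian : Vector Vertex 3 → Vector Vertex 3 → Set
  QuasiMedian u v = MetricTriangle v
    × (∀ i j → i ≢ j → d (u i) (u j) ≡ d (u i) (v i) + d (v i) (v j) + d (v j) (u j))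

open Graph using (Vertex)

Image : ∀ {A B : Set} → (A → B) → Pred B 0ℓ
Image f y = ∃ λ x → f x ≡ y

Isometric : (G H : Graph) → (Vertex G → Vertex H) → Set
Isometric G H f = ∀ u v → Graph.d H (f u) (f v) ≡ Graph.d G u v

Induced : (G H : Graph) → (Vertex G → Vertex H) → Set
Induced G H f = Injective _≡_ _≡_ f × (∀ u v → Graph._~_ G u v ⇔ Graph._~_ H (f u) (f v))

-- Vertices 0 and 3 are the ends of the two triangles; {1, 2} is their common edge.
K₄⁻ : Graph
K₄⁻ = record
  { Vertex    = Fin 4
  ; finite    = 4 , ↔-id _
  ; _~_       = _~_
  ; ~-dec     = λ u v → ¬? (u Fin.≟ v) ×-dec ¬? (u Fin.≟ 0F ×-dec v Fin.≟ 3F)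
                                       ×-dec ¬? (u Fin.≟ 3F ×-dec v Fin.≟ 0F)
  ; ~-sym     = ~-sym
  ; ~-irrefl  = λ u≡v (u≢v , _) → u≢v u≡v
  ; connected = walk-from-root ~-sym reach
  }
  where
  _~_ : Rel (Fin 4) 0ℓ
  u ~ v = u ≢ v × ¬ (u ≡ 0F × v ≡ 3F) × ¬ (u ≡ 3F × v ≡ 0F)

  ~-sym : Symmetric _~_
  ~-sym (u≢v , a , b) = ≢-sym u≢v , (λ (p , q) → b (q , p)) , (λ (p , q) → a (q , p))

  reach : ∀ v → ∃ λ k → Walk _~_ k 1F v
  reach 0F = 1 , ((λ ()) , (λ ()) , (λ ())) ∷ []
  reach 1F = 0 , []
  reach 2F = 1 , ((λ ()) , (λ ()) , (λ ())) ∷ []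
  reach 3F = 1 , ((λ ()) , (λ ()) , (λ ())) ∷ []

C₆ : Graph
C₆ = record
  { Vertex    = Fin 6
  ; finite    = 6 , ↔-id _
  ; _~_       = _~_
  ; ~-dec     = λ u v → toℕ v ℕ.≟ suc (toℕ u) % 6 ⊎-dec toℕ u ℕ.≟ suc (toℕ v) % 6
  ; ~-sym     = swap
  ; ~-irrefl  = λ { refl → irrefl _ }
  ; connected = walk-from-root swap reach
  }
  where
  _~_ : Rel (Fin 6) 0ℓ
  u ~ v = toℕ v ≡ suc (toℕ u) % 6 ⊎ toℕ u ≡ suc (toℕ v) % 6

  irrefl : ∀ u → ¬ u ~ u
  irrefl 0F = λ { (inj₁ ()) ; (inj₂ ()) }
  irrefl 1F = λ { (inj₁ ()) ; (inj₂ ()) }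
  irrefl 2F = λ { (inj₁ ()) ; (inj₂ ()) }
  irrefl 3F = λ { (inj₁ ()) ; (inj₂ ()) }
  irrefl 4F = λ { (inj₁ ()) ; (inj₂ ()) }
  irrefl 5F = λ { (inj₁ ()) ; (inj₂ ()) }

  reach : ∀ v → ∃ λ k → Walk _~_ k 0F v
  reach 0F = 0 , []
  reach 1F = 1 , inj₁ refl ∷ []
  reach 2F = 2 , _∷_ {v = 1F} (inj₁ refl) (inj₁ refl ∷ [])
  reach 3F = 3 , _∷_ {v = 1F} (inj₁ refl) (_∷_ {v = 2F} (inj₁ refl) (inj₁ refl ∷ []))
  reach 4F = 2 , _∷_ {v = 5F} (inj₂ refl) (inj₂ refl ∷ [])
  reach 5F = 1 , inj₂ refl ∷ []

-- The product U = U₁ × ⋯ × Uₘ, with Uᵢ = Fin nᵢ.  An inductive type of tuples,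
-- unlike a function type, makes equality of vertices propositional.
Tuple : ∀ {m} → Vec ℕ m → Set
Tuple n = All Fin n

infix 8 _!_

_!_ : ∀ {m} {n : Vec ℕ m} → Tuple n → (i : Fin m) → Fin (lookup n i)
_!_ = lookup⁺

tuple-finite : ∀ {m} (n : Vec ℕ m) → Finite (Tuple n)
tuple-finite []       = 1 , mk↔ₛ′ (λ _ → zero) (λ _ → []) (λ { zero → refl }) (λ { [] → refl })
tuple-finite (k ∷ n) with tuple-finite n
... | N , f = k * N , ↔-sym *↔× ↔-∘ ((↔-id _ ×-↔ f) ↔-∘ split)
  where
  split : Tuple (k ∷ n) ↔ (Fin k × Tuple n)
  split = mk↔ₛ′ (λ { (x ∷ u) → x , u }) (λ (x , u) → x ∷ u)
                (λ _ → refl) (λ { (_ ∷ _) → refl })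

_~ₕ_ : ∀ {m} {n : Vec ℕ m} → Rel (Tuple n) 0ℓ
u ~ₕ v = ∃! _≡_ λ i → u ! i ≢ v ! i

~ₕ-dec : ∀ {m} {n : Vec ℕ m} → Decidable (_~ₕ_ {n = n})
~ₕ-dec u v = any? λ i → ¬? (u ! i Fin.≟ v ! i) ×-dec
  map′ (λ h {j} → h j) (λ h j → h)
       (all? λ j → ¬? (u ! j Fin.≟ v ! j) →-dec i Fin.≟ j)

~ₕ-head : ∀ {m k} {n : Vec ℕ m} {x y : Fin k} (u : Tuple n) →
          x ≢ y → (x ∷ u) ~ₕ (y ∷ u)
~ₕ-head u x≢y = zero , x≢y , λ { {zero} _ → refl ; {suc _} ne → ⊥-elim (ne refl) }

~ₕ-tail : ∀ {m k} {n : Vec ℕ m} (x : Fin k) {u v : Tuple n} →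
          u ~ₕ v → (x ∷ u) ~ₕ (x ∷ v)
~ₕ-tail x (i , ne , unique) = suc i , ne ,
  λ { {zero} xx → ⊥-elim (xx refl) ; {suc _} ne′ → cong suc (unique ne′) }

walk-tail : ∀ {m k l} {n : Vec ℕ m} (x : Fin k) {u v : Tuple n} →
            Walk _~ₕ_ l u v → Walk _~ₕ_ l (x ∷ u) (x ∷ v)
walk-tail x []      = []
walk-tail x (e ∷ p) = ~ₕ-tail x e ∷ walk-tail x p

~ₕ-connected : ∀ {m} {n : Vec ℕ m} (u v : Tuple n) → ∃ λ k → Walk _~ₕ_ k u v
~ₕ-connected []      []      = 0 , []
~ₕ-connected (x ∷ u) (y ∷ v) with x Fin.≟ y | ~ₕ-connected u v
... | yes refl | k , p = k , walk-tail x p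
... | no x≢y   | k , p = suc k , ~ₕ-head u x≢y ∷ walk-tail y p

Hamming : ∀ {m} → Vec ℕ m → Graph
Hamming n = record
  { Vertex    = Tuple n
  ; finite    = tuple-finite n
  ; _~_       = _~ₕ_
  ; ~-dec     = ~ₕ-dec
  ; ~-sym     = λ (i , ne , unique) → i , ≢-sym ne , λ ne′ → unique (≢-sym ne′)
  ; ~-irrefl  = λ { refl (_ , ne , _) → ne refl }
  ; connected = ~ₕ-connected
  }

Q₃ : Graph
Q₃ = Hamming (2 ∷ 2 ∷ 2 ∷ [])

record IsQuasiMedian (G : Graph) : Set₁ where
  open Graph G hiding (Vertex)
  field
    unique-quasi-median : ∀ u → ∃! _≗_ (QuasiMedian u)
    equilateral         : ∀ u v → QuasiMedian u v → Equilateral v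
    kite-free           : ¬ ∃ (Induced K₄⁻ G)
    hull-of-6-cycle     : ∀ (c : Vertex C₆ → Vertex G) → Isometric C₆ G c →
      ∃ λ (q : Vertex Q₃ → Vertex G) → Induced Q₃ G q × (Image q ≐ ConvexHull (Image c))

record Partition (n : ℕ) : Set where
  field
    size     : ℕ
    block    : Fin size → Subset n
    nonempty : ∀ b → Nonempty (block b)
    covers   : ∀ x → ∃! _≡_ λ b → x ∈ₛ block b

open Partition

module _ {m : ℕ} {n : Vec ℕ m} where

  Product : (∀ i → Subset (lookup n i)) → Pred (Tuple n) 0ℓ
  Product W u = ∀ i → u ! i ∈ₛ W i

  GeneralizedPartition : Set
  GeneralizedPartition = ∀ i → Partition (lookup n i)

  MinorSubproduct : GeneralizedPartition → Set
  MinorSubproduct Λ = ∀ i → Fin (size (Λ i))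

  Box : (Λ : GeneralizedPartition) → MinorSubproduct Λ → Pred (Tuple n) 0ℓ
  Box Λ β = Product λ i → block (Λ i) (β i)

  Shattered : Pred (Tuple n) 0ℓ → GeneralizedPartition → Set
  Shattered S Λ = ∀ β → ∃ (S ∩ Box Λ β)

  -- The blocks cover Uᵢ, so Wᵢ has no elements besides the chosen ones.
  IsTransversal : GeneralizedPartition → (∀ i → Subset (lookup n i)) → Set
  IsTransversal Λ W = ∀ i b → ∃! _≡_ λ x → x ∈ₛ W i × x ∈ₛ block (Λ i) b

  StronglyShattered : Pred (Tuple n) 0ℓ → GeneralizedPartition → Set
  StronglyShattered S Λ = ∃ λ W → IsTransversal Λ W × Product W ⊆ S

  Ample : Pred (Tuple n) 0ℓ → Set
  Ample S = ∀ Λ → Shattered S Λ → StronglyShattered S Λ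

{-# OPTIONS --safe #-}
-- Let S be the image of the quasi-median graph.
--
-- S is closed under the dual discriminator T, which takes u, v, w to the point
-- with i-th coordinate v i if v i = w i and u i otherwise.  A minimal failure
-- is a metric triangle u, v, w.  Each of the three ways in which exactly two
-- of its vertices agree at a coordinate then occurs, say at a, b and c, and
-- minimality puts into S three neighbours of z = T u v w that differ from z at
-- a, b and c respectively.  They span a 6-cycle unless z ∈ S, and the convex
-- hull of a 6-cycle is a 3-cube, which contains z.
--
-- Call K ⊆ S absorbing if T maps into K whenever two of its arguments are in K.
-- Majority voting gives the Helly property for absorbing sets.  If S meets all
-- boxes, the points of S at which every value taken by S in direction i is
-- available form an absorbing set, and these sets meet pairwise; a common
-- point supplies the coordinates in which the partition is trivial, and in the
-- remaining coordinates all combinations of values occur, again by Helly.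
module Submission where

open import Defs
open import Algebra.Properties.CommutativeMonoid.Sum using ()
open import Data.Bool using (Bool; true; false; if_then_else_)
open import Data.Empty using (⊥; ⊥-elim)
open import Data.Fin using (Fin; zero; suc; fromℕ<)
open import Data.Fin.Patterns using (0F; 1F; 2F; 3F; 4F; 5F)
import Data.Fin.Properties as Fin
open import Data.Fin.Subset using (Subset) renaming (_∈_ to _∈ₛ_)
open import Data.Nat using (ℕ; zero; suc; NonZero; >-nonZero⁻¹; _+_; _≤_; _<_; z≤n; s≤s)
open import Data.Nat.Properties as ℕ using (+-0-commutativeMonoid; ≤-refl; ≤-trans; ≤-reflexive)
open import Data.Nat.Tactic.RingSolver using (solve-∀)
open import Data.Product using (∃; _×_; _,_; proj₁; proj₂)
open import Data.Sum using (_⊎_; inj₁; inj₂; map)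
open import Data.Vec using (Vec; []; _∷_; lookup; tabulate)
import Data.Vec.Functional as F
open import Data.Vec.Properties using ([]=⇒lookup; lookup⇒[]=; lookup∘tabulate)
open import Data.Vec.Relation.Unary.All using (All; []; _∷_)
open import Data.Vec.Relation.Unary.All.Properties using (lookup⁺; lookup⁻)
open import Function using (_∘_; Equivalence)
open import Level using (0ℓ)
open import Relation.Binary using (DecidableEquality)
open import Relation.Binary.PropositionalEquality
  using (_≡_; _≢_; refl; sym; trans; cong; cong₂; subst; subst₂; ≢-sym; module ≡-Reasoning)
open import Relation.Nullary using (¬_; Dec; yes; no; does; contradiction)
open import Relation.Nullary.Decidable using (¬?; _×-dec_; decidable-stable; dec-true; from-yes)
open import Relation.Unary using (Pred; _∩_)

open Algebra.Properties.CommutativeMonoid.Sum +-0-commutativeMonoid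
  using (sum; ∑-distrib-+; sum-cong-≗; sum-replicate-zero)

open Graph using (Vertex)

-- Monotonicity of finite sums.

sum-mono-≤ : ∀ {m} {f g : Fin m → ℕ} → (∀ i → f i ≤ g i) → sum f ≤ sum g
sum-mono-≤ {zero}  f≤g = z≤n
sum-mono-≤ {suc m} f≤g = ℕ.+-mono-≤ (f≤g zero) (sum-mono-≤ (f≤g ∘ suc))

sum-mono-< : ∀ {m} {f g : Fin m → ℕ} → (∀ i → f i ≤ g i) → ∀ k → f k < g k → sum f < sum g
sum-mono-< f≤g zero    f<g = ℕ.+-mono-<-≤ f<g (sum-mono-≤ (f≤g ∘ suc))
sum-mono-< f≤g (suc k) f<g = ℕ.+-mono-≤-< (f≤g zero) (sum-mono-< (f≤g ∘ suc) k f<g)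

sum-≡⇒≡ : ∀ {m} {f g : Fin m → ℕ} → (∀ i → f i ≤ g i) → sum f ≡ sum g → ∀ i → f i ≡ g i
sum-≡⇒≡ {f = f} {g} f≤g eq i with ℕ.m≤n⇒m<n∨m≡n (f≤g i)
... | inj₁ f<g = contradiction eq (ℕ.<⇒≢ (sum-mono-< f≤g i f<g))
... | inj₂ f≡g = f≡g

-- The discrete metric and the dual discriminator on one coordinate.

module Discrete {A : Set} (_≟_ : DecidableEquality A) where

  δ : A → A → ℕ
  δ x y = if does (x ≟ y) then 0 else 1

  δ-≡ : ∀ {x y} → x ≡ y → δ x y ≡ 0
  δ-≡ {x} {y} x≡y with x ≟ y
  ... | yes _  = refl
  ... | no x≢y = contradiction x≡y x≢y

  δ-≢ : ∀ {x y} → x ≢ y → δ x y ≡ 1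
  δ-≢ {x} {y} x≢y with x ≟ y
  ... | yes x≡y = contradiction x≡y x≢y
  ... | no _    = refl

  δ≡0⇒≡ : ∀ {x y} → δ x y ≡ 0 → x ≡ y
  δ≡0⇒≡ {x} {y} eq with x ≟ y
  ... | yes x≡y = x≡y

  δ≤1 : ∀ x y → δ x y ≤ 1
  δ≤1 x y with x ≟ y
  ... | yes _ = z≤n
  ... | no _  = s≤s z≤n

  δ-sym : ∀ x y → δ x y ≡ δ y x
  δ-sym x y with x ≟ y
  ... | yes x≡y = sym (δ-≡ (sym x≡y))
  ... | no x≢y  = sym (δ-≢ (≢-sym x≢y))

  δ-triangle : ∀ x y z → δ x z ≤ δ x y + δ y z
  δ-triangle x y z with x ≟ y
  ... | yes refl = ≤-refl
  ... | no _     = ≤-trans (δ≤1 x z) (s≤s z≤n)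

  δ-between : ∀ {x y z} → δ x y + δ y z ≡ δ x z → y ≡ x ⊎ y ≡ z
  δ-between {x} {y} {z} eq with x ≟ y | y ≟ z | x ≟ z
  ... | yes x≡y | _       | _     = inj₁ (sym x≡y)
  ... | no _    | yes y≡z | _     = inj₂ y≡z
  δ-between () | no _ | no _ | yes _
  δ-between () | no _ | no _ | no _

  between-δ : ∀ {x y z} → y ≡ x ⊎ y ≡ z → δ x y + δ y z ≡ δ x z
  between-δ {x} {y} {z} (inj₁ refl) = cong (_+ δ y z) (δ-≡ {y} refl)
  between-δ {x} {y} {z} (inj₂ refl) = trans (cong (δ x y +_) (δ-≡ {y} refl)) (ℕ.+-identityʳ _)

  -- The dual discriminator.  In a Hamming graph it yields, coordinate by
  -- coordinate, the vertex at x of the quasi-median of x, y, z.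
  t : A → A → A → A
  t x y z = if does (y ≟ z) then y else x

  t-cong : ∀ {x y z x′ y′ z′} → x ≡ x′ → y ≡ y′ → z ≡ z′ → t x y z ≡ t x′ y′ z′
  t-cong refl refl refl = refl

  t-≡ : ∀ {x y z} → y ≡ z → t x y z ≡ y
  t-≡ {x} {y} {z} y≡z with y ≟ z
  ... | yes _  = refl
  ... | no y≢z = contradiction y≡z y≢z

  t-≢ : ∀ {x y z} → y ≢ z → t x y z ≡ x
  t-≢ {x} {y} {z} y≢z with y ≟ z
  ... | yes y≡z = contradiction y≡z y≢z
  ... | no _    = refl

  t-left : ∀ {x y z} → x ≡ y → t x y z ≡ x
  t-left {x} {y} {z} x≡y with y ≟ z
  ... | yes _ = sym x≡y
  ... | no _  = refl

  t-outer : ∀ {x y z} → x ≡ z → t x y z ≡ x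
  t-outer {x} {y} {z} x≡z with y ≟ z
  ... | yes y≡z = trans y≡z (sym x≡z)
  ... | no _    = refl

  t-betweenˡ : ∀ x y z → t x y z ≡ x ⊎ t x y z ≡ y
  t-betweenˡ x y z with y ≟ z
  ... | yes _ = inj₂ refl
  ... | no _  = inj₁ refl

  t-betweenʳ : ∀ x y z → t x y z ≡ x ⊎ t x y z ≡ z
  t-betweenʳ x y z with y ≟ z
  ... | yes y≡z = inj₂ y≡z
  ... | no _    = inj₁ refl

  t-comm : ∀ x y z → t x y z ≡ t x z y
  t-comm x y z with y ≟ z | z ≟ y
  ... | yes y≡z | yes _   = y≡z
  ... | yes y≡z | no z≢y  = contradiction (sym y≡z) z≢y
  ... | no y≢z  | yes z≡y = contradiction (sym z≡y) y≢z
  ... | no _    | no _    = refl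

  t-idem : ∀ x y z → t x (t x y z) y ≡ t x y z
  t-idem x y z with y ≟ z
  ... | yes _ = t-≡ refl
  ... | no _  = t-left refl

  ν : A → A → A → ℕ
  ν x y z = δ x y + δ y z + δ z x

  ν-refl : ∀ x → ν x x x ≡ 0
  ν-refl x = cong (λ k → k + k + k) (δ-≡ {x} refl)

  ν≤3 : ∀ x y z → ν x y z ≤ 3
  ν≤3 x y z = ℕ.+-mono-≤ (ℕ.+-mono-≤ (δ≤1 x y) (δ≤1 y z)) (δ≤1 z x)

  ν-distinct : ∀ {x y z} → x ≢ y → y ≢ z → z ≢ x → ν x y z ≡ 3
  ν-distinct x≢y y≢z z≢x = cong₂ _+_ (cong₂ _+_ (δ-≢ x≢y) (δ-≢ y≢z)) (δ-≢ z≢x)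

  -- As `t x y z` is `x` or `y`, the left side is twice `δ x y`. The second copy is matched by
  -- `δ z x` if `y ≡ z`, and otherwise by `δ y z`, which is 1.
  ν-t : ∀ x y z → ν x (t x y z) y ≤ ν x y z
  ν-t x y z with y ≟ z
  ... | yes refl = ≤-reflexive (cong (λ k → δ x y + k + δ y x) (δ-≡ {y} refl))
  ... | no _     = ≤-trans
    (≤-reflexive (trans (cong (λ k → k + δ x y + δ y x) (δ-≡ {x} refl)) (ℕ.+-comm (δ x y) _)))
    (≤-trans (ℕ.+-mono-≤ (δ≤1 y x) ≤-refl)
             (≤-trans (≤-reflexive (ℕ.+-comm 1 (δ x y))) (ℕ.m≤m+n _ (δ z x))))

  -- On one coordinate a geodesic through `x`, `a`, `b`, `y` changes value at most once. This lemma
  -- and the next two read off where.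
  path-≡ : ∀ {x y a b} → δ x y ≡ δ x a + δ a b + δ b y → x ≡ y → a ≡ x × b ≡ x
  path-≡ {x} {y} {a} {b} eq refl = sym x≡a , b≡y
    where
    eq₀ : δ x a + δ a b + δ b x ≡ 0
    eq₀ = trans (sym eq) (δ-≡ {x} refl)
    x≡a : x ≡ a
    x≡a = δ≡0⇒≡ (ℕ.m+n≡0⇒m≡0 _ (ℕ.m+n≡0⇒m≡0 _ eq₀))
    b≡y : b ≡ x
    b≡y = δ≡0⇒≡ (ℕ.m+n≡0⇒n≡0 (δ x a + δ a b) eq₀)

  path-≢ : ∀ {x y a b} → δ x y ≡ δ x a + δ a b + δ b y → a ≢ x → a ≡ y
  path-≢ {x} {y} {a} {b} eq a≢x = trans (δ≡0⇒≡ (proj₁ zeros)) (δ≡0⇒≡ (proj₂ zeros))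
    where
    eq₁ : δ a b + δ b y ≤ 0
    eq₁ = ℕ.≤-pred (≤-trans (≤-reflexive (trans (cong (λ k → k + δ a b + δ b y) (sym (δ-≢ (≢-sym a≢x)))) (sym eq))) (δ≤1 x y))
    zeros : δ a b ≡ 0 × δ b y ≡ 0
    zeros = ℕ.m+n≡0⇒m≡0 _ (ℕ.n≤0⇒n≡0 eq₁) , ℕ.m+n≡0⇒n≡0 (δ a b) (ℕ.n≤0⇒n≡0 eq₁)

  path-≢ʳ : ∀ {x y a b} → δ x y ≡ δ x a + δ a b + δ b y → b ≢ y → b ≡ x
  path-≢ʳ {x} {y} {a} {b} eq b≢y = sym (trans (δ≡0⇒≡ (ℕ.m+n≡0⇒m≡0 _ zeros)) (δ≡0⇒≡ (ℕ.m+n≡0⇒n≡0 (δ x a) zeros)))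
    where
    zeros : δ x a + δ a b ≡ 0
    zeros = ℕ.n≤0⇒n≡0 (ℕ.+-cancelʳ-≤ 1 (δ x a + δ a b) 0 (≤-trans
      (≤-reflexive (trans (cong (δ x a + δ a b +_) (sym (δ-≢ b≢y))) (sym eq))) (δ≤1 x y)))

  -- A quasi-median of x, y, z need not be the one computed by t (it may
  -- stop early), but t does not change along it.
  t-quasi-median : ∀ {x y z a b c} →
    δ x y ≡ δ x a + δ a b + δ b y →
    δ y z ≡ δ y b + δ b c + δ c z →
    δ z x ≡ δ z c + δ c a + δ a x →
    t a b c ≡ t x y z
  t-quasi-median {x} {y} {z} {a} {b} {c} xy yz zx = by (x ≟ y) (y ≟ z) (z ≟ x)
    where
    by : Dec (x ≡ y) → Dec (y ≡ z) → Dec (z ≡ x) → t a b c ≡ t x y z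
    by _ (yes y≡z) _ =
      let b≡y , c≡y = path-≡ yz y≡z in
      trans (t-≡ (trans b≡y (sym c≡y))) (trans b≡y (sym (t-≡ y≡z)))
    by (yes x≡y) _ _ =
      let a≡x , b≡x = path-≡ xy x≡y in
      trans (t-left (trans a≡x (sym b≡x))) (trans a≡x (sym (t-left x≡y)))
    by _ _ (yes z≡x) =
      let c≡z , a≡z = path-≡ zx z≡x in
      trans (t-outer (trans a≡z (sym c≡z))) (trans (trans a≡z z≡x) (sym (t-outer (sym z≡x))))
    by (no x≢y) (no y≢z) (no z≢x) = trans (t-≢ b≢c) (trans a≡x (sym (t-≢ y≢z)))
      where
      endpoint : ∀ {p q r : A} → (p ≢ q → p ≡ r) → (p ≢ q → p ≡ r → ⊥) → p ≡ q
      endpoint {p} {q} f g with p ≟ q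
      ... | yes p≡q = p≡q
      ... | no p≢q  = ⊥-elim (g p≢q (f p≢q))
      -- If `a` left `x`, the path from `x` to `y` would give `a ≡ y` and the path from `z` to `x`
      -- would give `a ≡ z`, although `y` and `z` differ. Likewise for `b` and `c`.
      a≡x : a ≡ x
      a≡x = endpoint (path-≢ xy) λ n a≡y → y≢z (trans (sym a≡y) (path-≢ʳ zx n))
      b≡y : b ≡ y
      b≡y = endpoint (path-≢ yz) λ n b≡z → z≢x (trans (sym b≡z) (path-≢ʳ xy n))
      c≡z : c ≡ z
      c≡z = endpoint (path-≢ zx) λ n c≡x → x≢y (trans (sym c≡x) (path-≢ʳ yz n))
      b≢c : b ≢ c
      b≢c b≡c = y≢z (trans (sym b≡y) (trans b≡c c≡z))

  -- Adding the three path equations counts every leg such as `δ x a` twice. One copy is enough to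
  -- make the quasi-median strictly shorter whenever a leg is nontrivial.
  ν-quasi-median : ∀ {x y z a b c} →
    δ x y ≡ δ x a + δ a b + δ b y →
    δ y z ≡ δ y b + δ b c + δ c z →
    δ z x ≡ δ z c + δ c a + δ a x →
    ν a b c + (δ x a + δ y b + δ z c) ≤ ν x y z
  ν-quasi-median {x} {y} {z} {a} {b} {c} xy yz zx = begin
    ν a b c + (δ x a + δ y b + δ z c)
      ≤⟨ ℕ.m≤m+n _ (δ b y + δ c z + δ a x) ⟩
    ν a b c + (δ x a + δ y b + δ z c) + (δ b y + δ c z + δ a x)
      ≡⟨ rearrange (δ x a) (δ a b) (δ b y) (δ y b) (δ b c) (δ c z) (δ z c) (δ c a) (δ a x) ⟩
    (δ x a + δ a b + δ b y) + (δ y b + δ b c + δ c z) + (δ z c + δ c a + δ a x)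
      ≡⟨ cong₂ _+_ (cong₂ _+_ xy yz) zx ⟨
    ν x y z ∎
    where
    open ℕ.≤-Reasoning
    rearrange : ∀ p q r p′ q′ r′ p″ q″ r″ →
      q + q′ + q″ + (p + p′ + p″) + (r + r′ + r″) ≡ (p + q + r) + (p′ + q′ + r′) + (p″ + q″ + r″)
    rearrange = solve-∀

-- Changing one coordinate of a point.

module _ {m : ℕ} {X : Fin m → Set} where

  infixl 10 _[_≔_]

  opaque
    _[_≔_] : (∀ i → X i) → (k : Fin m) → X k → ∀ i → X i
    (u [ k ≔ x ]) i with k Fin.≟ i
    ... | yes refl = x
    ... | no _     = u i

    update-same : ∀ (u : ∀ i → X i) k {x} → (u [ k ≔ x ]) k ≡ x
    update-same u k with k Fin.≟ k
    ... | yes refl = refl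
    ... | no k≢k   = contradiction refl k≢k

    update-other : ∀ (u : ∀ i → X i) {k i} {x} → k ≢ i → (u [ k ≔ x ]) i ≡ u i
    update-other u {k} {i} k≢i with k Fin.≟ i
    ... | yes k≡i = contradiction k≡i k≢i
    ... | no _    = refl

    update-elim : ∀ (u : ∀ i → X i) k {x} (P : ∀ i → X i → Set) →
                  P k x → (∀ i → k ≢ i → P i (u i)) → ∀ i → P i ((u [ k ≔ x ]) i)
    update-elim u k P at off i with k Fin.≟ i
    ... | yes refl = at
    ... | no k≢i   = off i k≢i

sum-update : ∀ {m} (f g : Fin m → ℕ) k → (∀ i → k ≢ i → f i ≡ g i) → sum f + g k ≡ sum g + f k
sum-update f g zero eq = begin
  f zero + sum (f ∘ suc) + g zero ≡⟨ cong (λ s → f zero + s + g zero) (sum-cong-≗ λ i → eq (suc i) λ ()) ⟩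
  f zero + sum (g ∘ suc) + g zero ≡⟨ rearrange (f zero) _ (g zero) ⟩
  g zero + sum (g ∘ suc) + f zero ∎
  where
  open ≡-Reasoning
  rearrange : ∀ a b c → a + b + c ≡ c + b + a
  rearrange = solve-∀
sum-update f g (suc k) eq = begin
  f zero + sum (f ∘ suc) + g (suc k)   ≡⟨ ℕ.+-assoc (f zero) _ _ ⟩
  f zero + (sum (f ∘ suc) + g (suc k)) ≡⟨ cong₂ _+_ (eq zero λ ()) (sum-update (f ∘ suc) (g ∘ suc) k
                                                    λ i k≢i → eq (suc i) (k≢i ∘ Fin.suc-injective)) ⟩
  g zero + (sum (g ∘ suc) + f (suc k)) ≡⟨ ℕ.+-assoc (g zero) _ _ ⟨
  g zero + sum (g ∘ suc) + f (suc k)   ∎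
  where open ≡-Reasoning

-- Hamming distance, intervals and metric triangles.

module Points {m : ℕ} {X : Fin m → Set} (_≟_ : ∀ {i} → DecidableEquality (X i)) where

  open module D {i : Fin m} = Discrete (_≟_ {i}) public

  Point : Set
  Point = ∀ i → X i

  infix 4 _≋_

  _≋_ : Point → Point → Set
  u ≋ v = ∀ i → u i ≡ v i

  ≋-sym : ∀ {u v} → u ≋ v → v ≋ u
  ≋-sym eq i = sym (eq i)

  update-cong : ∀ {u v} k {x} → u ≋ v → u [ k ≔ x ] ≋ v [ k ≔ x ]
  update-cong {u} {v} k {x} u≋v = update-elim u k (λ i y → y ≡ (v [ k ≔ x ]) i)
    (sym (update-same v k)) (λ i k≢i → trans (u≋v i) (sym (update-other v k≢i)))

  Between : Point → Point → Point → Set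
  Between u q v = ∀ i → q i ≡ u i ⊎ q i ≡ v i

  T : Point → Point → Point → Point
  T u v w i = t (u i) (v i) (w i)

  Δ : Point → Point → ℕ
  Δ u v = sum λ i → δ (u i) (v i)

  -- The perimeter of the triple, computed coordinatewise; the closure proof is an induction on it.
  N : Point → Point → Point → ℕ
  N u v w = sum λ i → ν (u i) (v i) (w i)

  Δ-cong : ∀ {u u′ v v′} → u ≋ u′ → v ≋ v′ → Δ u v ≡ Δ u′ v′
  Δ-cong u≋ v≋ = sum-cong-≗ λ i → cong₂ δ (u≋ i) (v≋ i)

  Δ-sym : ∀ u v → Δ u v ≡ Δ v u
  Δ-sym u v = sum-cong-≗ λ i → δ-sym (u i) (v i)

  Δ-refl : ∀ u → Δ u u ≡ 0
  Δ-refl u = trans (sum-cong-≗ λ i → δ-≡ {x = u i} refl) (sum-replicate-zero m)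

  Δ-triangle : ∀ u q v → Δ u v ≤ Δ u q + Δ q v
  Δ-triangle u q v = ≤-trans (sum-mono-≤ λ i → δ-triangle (u i) (q i) (v i))
                             (≤-reflexive (∑-distrib-+ (λ i → δ (u i) (q i)) (λ i → δ (q i) (v i))))

  -- The triangle inequality holds in each coordinate, so equality of the sums forces equality in
  -- every coordinate.
  Δ-between : ∀ {u q v} → Δ u q + Δ q v ≡ Δ u v → Between u q v
  Δ-between {u} {q} {v} eq i = δ-between (sym (sum-≡⇒≡ (λ j → δ-triangle (u j) (q j) (v j))
    (trans (sym eq) (sym (∑-distrib-+ (λ j → δ (u j) (q j)) (λ j → δ (q j) (v j))))) i))

  between-Δ : ∀ {u q v} → Between u q v → Δ u q + Δ q v ≡ Δ u v
  between-Δ {u} {q} {v} btw = trans (sym (∑-distrib-+ (λ j → δ (u j) (q j)) (λ j → δ (q j) (v j))))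
                                    (sum-cong-≗ λ i → between-δ (btw i))

  Δ-path : ∀ {u a b v} → Δ u v ≡ Δ u a + Δ a b + Δ b v →
           ∀ i → δ (u i) (v i) ≡ δ (u i) (a i) + δ (a i) (b i) + δ (b i) (v i)
  Δ-path {u} {a} {b} {v} eq = sum-≡⇒≡
    (λ i → ≤-trans (δ-triangle (u i) (b i) (v i)) (ℕ.+-monoˡ-≤ _ (δ-triangle (u i) (a i) (b i))))
    (trans eq (sym (trans (∑-distrib-+ (λ i → δ (u i) (a i) + δ (a i) (b i)) (λ i → δ (b i) (v i)))
                          (cong (_+ Δ b v) (∑-distrib-+ (λ i → δ (u i) (a i)) (λ i → δ (a i) (b i)))))))

  Δ-update : ∀ {u v k x y} → u k ≡ v k → Δ (u [ k ≔ x ]) (v [ k ≔ y ]) ≡ Δ u v + δ x y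
  Δ-update {u} {v} {k} {x} {y} uk≡vk = begin
    Δ u′ v′                   ≡⟨ ℕ.+-identityʳ _ ⟨
    Δ u′ v′ + 0               ≡⟨ cong (Δ u′ v′ +_) (δ-≡ uk≡vk) ⟨
    Δ u′ v′ + δ (u k) (v k)   ≡⟨ sum-update (λ i → δ (u′ i) (v′ i)) (λ i → δ (u i) (v i)) k
                                   (λ i k≢i → cong₂ δ (update-other u k≢i) (update-other v k≢i)) ⟩
    Δ u v + δ (u′ k) (v′ k)   ≡⟨ cong (Δ u v +_) (cong₂ δ (update-same u k) (update-same v k)) ⟩
    Δ u v + δ x y             ∎
    where
    open ≡-Reasoning
    u′ = u [ k ≔ x ]
    v′ = v [ k ≔ y ]

  Δ-step : ∀ {u v} k → u k ≢ v k → Δ (u [ k ≔ v k ]) v < Δ u v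
  Δ-step {u} {v} k uk≢vk = sum-mono-<
    (update-elim u k (λ i x → δ x (v i) ≤ δ (u i) (v i)) (≤-trans (≤-reflexive (δ-≡ refl)) z≤n) λ _ _ → ≤-refl)
    k (subst₂ _<_ (sym (δ-≡ (update-same u k))) (sym (δ-≢ uk≢vk)) (s≤s z≤n))

  Δ≤1-unique : ∀ {u v} → Δ u v ≤ 1 → ∀ {i j} → u i ≢ v i → u j ≢ v j → i ≡ j
  Δ≤1-unique {u} {v} Δ≤1 {i} {j} ui≢vi uj≢vj with i Fin.≟ j
  ... | yes i≡j = i≡j
  ... | no i≢j  = contradiction
    (≤-trans (≤-trans (s≤s (ℕ.≤-trans (s≤s z≤n) (Δ-step {u [ i ≔ v i ]} {v} j
        λ eq → uj≢vj (trans (sym (update-other u i≢j)) eq)))) (Δ-step {u} {v} i ui≢vi)) Δ≤1)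
    λ { (s≤s ()) }

  Δ-single : ∀ {u v} k → (∀ i → k ≢ i → u i ≡ v i) → Δ u v ≡ δ (u k) (v k)
  Δ-single {u} {v} k eq = begin
    Δ u v                 ≡⟨ ℕ.+-identityʳ _ ⟨
    Δ u v + 0             ≡⟨ sum-update (λ i → δ (u i) (v i)) (λ _ → 0) k (λ i k≢i → δ-≡ (eq i k≢i)) ⟩
    sum {m} (λ _ → 0) + δ (u k) (v k) ≡⟨ cong (_+ δ (u k) (v k)) (sum-replicate-zero m) ⟩
    δ (u k) (v k)         ∎
    where open ≡-Reasoning

  between-step : ∀ {u v} k → Between u (u [ k ≔ v k ]) v
  between-step {u} {v} k = update-elim u k (λ i x → x ≡ u i ⊎ x ≡ v i) (inj₂ refl) λ _ _ → inj₁ refl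

  T-betweenˡ : ∀ u v w → Between u (T u v w) v
  T-betweenˡ u v w i = t-betweenˡ (u i) (v i) (w i)

  T-betweenʳ : ∀ u v w → Between u (T u v w) w
  T-betweenʳ u v w i = t-betweenʳ (u i) (v i) (w i)

  record Triangle (S : Pred Point 0ℓ) (u v w : Point) : Set where
    field
      u∈S    : S u
      v∈S    : S v
      w∈S    : S w
      apex-u : ∀ {x} → S x → Between u x v → Between u x w → x ≋ u
      apex-v : ∀ {x} → S x → Between v x w → Between v x u → x ≋ v
      apex-w : ∀ {x} → S x → Between w x u → Between w x v → x ≋ w
      Δuv≡vw : Δ u v ≡ Δ v w
      Δvw≡wu : Δ v w ≡ Δ w u

  triangle-flip : ∀ {S u v w} → Triangle S u v w → Triangle S u w v
  triangle-flip {u = u} {v} {w} T = record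
    { u∈S = u∈S ; v∈S = w∈S ; w∈S = v∈S
    ; apex-u = λ x∈S p q → apex-u x∈S q p
    ; apex-v = λ x∈S p q → apex-w x∈S q p
    ; apex-w = λ x∈S p q → apex-v x∈S q p
    ; Δuv≡vw = trans (Δ-sym u w) (trans (sym Δvw≡wu) (Δ-sym v w))
    ; Δvw≡wu = trans (Δ-sym w v) (trans (sym Δuv≡vw) (Δ-sym u v))
    }
    where open Triangle T

  triangle-rotate : ∀ {S u v w} → Triangle S u v w → Triangle S v w u
  triangle-rotate T = record
    { u∈S = v∈S ; v∈S = w∈S ; w∈S = u∈S
    ; apex-u = apex-v ; apex-v = apex-w ; apex-w = apex-u
    ; Δuv≡vw = Δvw≡wu
    ; Δvw≡wu = trans (sym Δvw≡wu) (sym Δuv≡vw)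
    }
    where open Triangle T

  triangle-resp : ∀ {S u v w u′ v′ w′} → Triangle S u v w → u ≋ u′ → v ≋ v′ → w ≋ w′ →
                  S u′ → S v′ → S w′ → Triangle S u′ v′ w′
  triangle-resp T u≋ v≋ w≋ u∈ v∈ w∈ = record
    { u∈S = u∈ ; v∈S = v∈ ; w∈S = w∈
    ; apex-u = apex-resp u≋ v≋ w≋ apex-u
    ; apex-v = apex-resp v≋ w≋ u≋ apex-v
    ; apex-w = apex-resp w≋ u≋ v≋ apex-w
    ; Δuv≡vw = trans (sym (Δ-cong u≋ v≋)) (trans Δuv≡vw (Δ-cong v≋ w≋))
    ; Δvw≡wu = trans (sym (Δ-cong v≋ w≋)) (trans Δvw≡wu (Δ-cong w≋ u≋))
    }
    where
    open Triangle T
    between-resp : ∀ {u v u′ v′ x} → u ≋ u′ → v ≋ v′ → Between u′ x v′ → Between u x v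
    between-resp u≋ v≋ btw i = map (λ p → trans p (sym (u≋ i))) (λ p → trans p (sym (v≋ i))) (btw i)
    apex-resp : ∀ {S : Pred Point 0ℓ} {u v w u′ v′ w′} → u ≋ u′ → v ≋ v′ → w ≋ w′ →
      (∀ {x} → S x → Between u x v → Between u x w → x ≋ u) →
      ∀ {x} → S x → Between u′ x v′ → Between u′ x w′ → x ≋ u′
    apex-resp u≋ v≋ w≋ apex x∈ p q i =
      trans (apex x∈ (between-resp u≋ v≋ p) (between-resp u≋ w≋ q) i) (u≋ i)

  -- `step` is the start of a geodesic: a point other than its target moves by adopting one
  -- coordinate of the target. In `hexagon`, the six points are the corners of a 3-cube with vertex
  -- `z`, apart from `z` and its antipode.
  record IsQuasiMedianSet (S : Pred Point 0ℓ) : Set where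
    field
      resp : ∀ {u v} → u ≋ v → S u → S v
      step : ∀ {u v} → S u → S v → ∀ i → u i ≢ v i → ∃ λ k → u k ≢ v k × S (u [ k ≔ v k ])
      quasi-median : ∀ {u v w} → S u → S v → S w → ∃ λ a → ∃ λ b → ∃ λ c → Triangle S a b c
        × Δ u v ≡ Δ u a + Δ a b + Δ b v
        × Δ v w ≡ Δ v b + Δ b c + Δ c w
        × Δ w u ≡ Δ w c + Δ c a + Δ a u
      hexagon : ∀ z {a b c x y w} → a ≢ b → b ≢ c → a ≢ c → z a ≢ x → z b ≢ y → z c ≢ w →
        S (z [ a ≔ x ]) → S (z [ a ≔ x ] [ b ≔ y ]) → S (z [ b ≔ y ]) →
        S (z [ b ≔ y ] [ c ≔ w ]) → S (z [ c ≔ w ]) → S (z [ a ≔ x ] [ c ≔ w ]) → S z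

  -- Closure under the dual discriminator.

  module Closure {S : Pred Point 0ℓ} (Q : IsQuasiMedianSet S) where

    open IsQuasiMedianSet Q

    ClosedBelow : ℕ → Set
    ClosedBelow n = ∀ {u v w} → S u → S v → S w → N u v w < n → S (T u v w)

    N-flip : ∀ u v w → N u v w ≡ N u w v
    N-flip u v w = sum-cong-≗ λ i → begin
      δ (u i) (v i) + δ (v i) (w i) + δ (w i) (u i)
        ≡⟨ cong₂ _+_ (cong₂ _+_ (δ-sym (u i) _) (δ-sym (v i) _)) (δ-sym (w i) _) ⟩
      δ (v i) (u i) + δ (w i) (v i) + δ (u i) (w i)
        ≡⟨ rearrange (δ (v i) (u i)) _ _ ⟩
      δ (u i) (w i) + δ (w i) (v i) + δ (v i) (u i) ∎
      where
      open ≡-Reasoning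
      rearrange : ∀ a b c → a + b + c ≡ c + b + a
      rearrange = solve-∀

    N-rotate : ∀ u v w → N u v w ≡ N v w u
    N-rotate u v w = sum-cong-≗ λ i → rearrange (δ (u i) (v i)) _ _
      where
      rearrange : ∀ a b c → a + b + c ≡ b + c + a
      rearrange = solve-∀

    N-reverse : ∀ u v w → N u v w ≡ N w v u
    N-reverse u v w = trans (N-flip u v w) (N-rotate u w v)

    -- Either the quasi-median is the triple itself, or some leg is nontrivial and the quasi-median
    -- has smaller perimeter. Then the induction hypothesis applies to it, and by `t-quasi-median`
    -- it has the same value of `T`.
    reduce : ∀ {n u v w} → ClosedBelow n → N u v w ≤ n → S u → S v → S w →
             Triangle S u v w ⊎ S (T u v w)
    reduce {n} {u} {v} {w} closed N≤n u∈ v∈ w∈ with quasi-median u∈ v∈ w∈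
    ... | a , b , c , tri , uv , vw , wu
      with Fin.any? (λ i → ¬? (u i ≟ a i ×-dec v i ≟ b i ×-dec w i ≟ c i))
    ... | no all≡ = inj₁ (triangle-resp tri
            (λ i → sym (proj₁ (eqs i))) (λ i → sym (proj₁ (proj₂ (eqs i)))) (λ i → sym (proj₂ (proj₂ (eqs i))))
            u∈ v∈ w∈)
      where
      eqs : ∀ i → u i ≡ a i × v i ≡ b i × w i ≡ c i
      eqs i = decidable-stable (u i ≟ a i ×-dec v i ≟ b i ×-dec w i ≟ c i) λ ≢ → all≡ (i , ≢)
    ... | yes (i , differ) = inj₂ (resp (λ j → t-quasi-median (Δ-path uv j) (Δ-path vw j) (Δ-path wu j))
            (closed u∈S v∈S w∈S (ℕ.<-≤-trans N< N≤n)))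
      where
      open Triangle tri
      excess : ∀ j → ν (a j) (b j) (c j) + (δ (u j) (a j) + δ (v j) (b j) + δ (w j) (c j)) ≤ ν (u j) (v j) (w j)
      excess j = ν-quasi-median (Δ-path uv j) (Δ-path vw j) (Δ-path wu j)
      positive : 0 < δ (u i) (a i) + δ (v i) (b i) + δ (w i) (c i)
      positive = ℕ.n≢0⇒n>0 λ ≡0 → differ
        ( δ≡0⇒≡ (ℕ.m+n≡0⇒m≡0 _ (ℕ.m+n≡0⇒m≡0 _ ≡0))
        , δ≡0⇒≡ (ℕ.m+n≡0⇒n≡0 (δ (u i) (a i)) (ℕ.m+n≡0⇒m≡0 _ ≡0))
        , δ≡0⇒≡ (ℕ.m+n≡0⇒n≡0 (δ (u i) (a i) + δ (v i) (b i)) ≡0))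
      N< : N a b c < N u v w
      N< = sum-mono-< (λ j → ℕ.m+n≤o⇒m≤o _ (excess j)) i
             (ℕ.<-≤-trans (ℕ.m<m+n _ positive) (excess i))

    -- Otherwise q and r would be strictly closer than p and q.
    odd-coordinate : ∀ {p q r i} → Triangle S p q r → q i ≡ r i → p i ≢ q i →
                     ∃ λ j → p j ≡ q j × q j ≢ r j
    odd-coordinate {p} {q} {r} {i} tri q≡r p≢q
      with Fin.any? (λ j → p j ≟ q j ×-dec ¬? (q j ≟ r j))
    ... | yes found = found
    ... | no none   = contradiction (sym (Triangle.Δuv≡vw tri)) (ℕ.<⇒≢
            (sum-mono-< (λ j → δ≤ (p j ≟ q j) (λ p≡q q≢r → none (j , p≡q , q≢r))) i
              (subst₂ _<_ (sym (δ-≡ q≡r)) (sym (δ-≢ p≢q)) (s≤s z≤n))))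
      where
      δ≤ : ∀ {j} {x y z : X j} → Dec (x ≡ y) → (x ≡ y → ¬ y ≢ z) → δ y z ≤ δ x y
      δ≤ {y = y} {z} (yes x≡y) f = ≤-trans (≤-reflexive (δ-≡ (decidable-stable (y ≟ z) (f x≡y)))) z≤n
      δ≤ {y = y} {z} (no x≢y) f = ≤-trans (δ≤1 y z) (≤-reflexive (sym (δ-≢ x≢y)))

    -- A first step from q towards r at a coordinate where p agrees with r would
    -- be a step towards p as well; one at a coordinate where p, q, r are distinct
    -- gives smaller triples from which T p q r is obtained, and T p q r
    -- contradicts the apex at p.
    step-to-odd : ∀ {n p q r i j} → ClosedBelow n → N p q r ≤ n → Triangle S p q r →
                  q i ≡ r i → p i ≢ q i → p j ≡ q j → q j ≢ r j →
                  ∃ λ k → p k ≡ q k × q k ≢ r k × S (q [ k ≔ r k ])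
    step-to-odd {n} {p} {q} {r} {i} {j} closed N≤n tri qi≡ri pi≢qi pj≡qj qj≢rj
      with step (Triangle.v∈S tri) (Triangle.w∈S tri) j qj≢rj
    ... | k , qk≢rk , x∈S with p k ≟ q k | r k ≟ p k
    ... | yes pk≡qk | _ = k , pk≡qk , qk≢rk , x∈S
    ... | no pk≢qk | yes rk≡pk = contradiction
            (trans (sym (apex-v x∈S (between-step k)
                          (subst (λ y → Between q (q [ k ≔ y ]) p) (sym rk≡pk) (between-step k)) k))
                   (update-same q k))
            qk≢rk
      where open Triangle tri
    ... | no pk≢qk | no rk≢pk = contradiction (sym (apex-u z∈S (T-betweenˡ p q r) (T-betweenʳ p q r) i))
            λ pi≡zi → pi≢qi (trans pi≡zi (t-≡ qi≡ri))
      where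
      open Triangle tri
      x y : Point
      x = q [ k ≔ r k ]
      -- The triple `p`, `x`, `r` is smaller, since its contribution at `k` drops from 3 to at most
      -- 2. Off `k` the point `y` agrees with `T p q r`; at `k` it equals `r k`.
      y = T p x r
      νk≡3 : ν (p k) (q k) (r k) ≡ 3
      νk≡3 = ν-distinct pk≢qk qk≢rk rk≢pk
      y∈S : S y
      y∈S = closed u∈S x∈S w∈S (ℕ.<-≤-trans (sum-mono-<
        (update-elim q k (λ l a → ν (p l) a (r l) ≤ ν (p l) (q l) (r l))
          (≤-trans (ν≤3 (p k) (r k) (r k)) (≤-reflexive (sym νk≡3))) λ _ _ → ≤-refl)
        k (subst₂ _<_ (sym (cong (λ a → ν (p k) a (r k)) (update-same q k))) (sym νk≡3)
            (s≤s (≤-trans (≤-reflexive (cong (λ a → δ (p k) (r k) + a + δ (r k) (p k)) (δ-≡ {x = r k} refl)))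
              (ℕ.+-mono-≤ (ℕ.+-mono-≤ (δ≤1 (p k) (r k)) (z≤n {0})) (δ≤1 (r k) (p k))))))) N≤n)
      y≡z : ∀ l → k ≢ l → y l ≡ T p q r l
      y≡z l k≢l = cong (λ a → t (p l) a (r l)) (update-other q k≢l)
      T-other : ∀ l → k ≢ l → ν (p l) (y l) (q l) ≤ ν (p l) (q l) (r l)
      T-other l k≢l = ≤-trans (≤-reflexive (cong (λ a → ν (p l) a (q l)) (y≡z l k≢l))) (ν-t (p l) (q l) (r l))
      N≤ : ∀ l → Dec (k ≡ l) → ν (p l) (y l) (q l) ≤ ν (p l) (q l) (r l)
      N≤ l (yes refl) = ≤-trans (ν≤3 (p k) (y k) (q k)) (≤-reflexive (sym νk≡3))
      N≤ l (no k≢l)   = T-other l k≢l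
      k≢j : k ≢ j
      k≢j refl = pk≢qk pj≡qj
      N< : ν (p j) (y j) (q j) < ν (p j) (q j) (r j)
      N< = subst₂ _<_
        (sym (trans (cong₂ (λ a b → ν a b (q j)) pj≡qj (trans (y≡z j k≢j) (trans (t-≢ qj≢rj) pj≡qj)))
              (ν-refl (q j))))
        (sym (cong₂ (λ a b → a + b + δ (r j) (p j)) (δ-≡ pj≡qj) (δ-≢ qj≢rj))) (s≤s z≤n)
      -- `T p q r` is recovered as `T p y q`. The triple `p`, `y`, `q` is smaller because its three
      -- points agree at `j`, where `q` and `r` differ.
      z∈S : S (T p q r)
      z∈S = resp (λ l → same l (k Fin.≟ l)) (closed u∈S y∈S v∈S (ℕ.<-≤-trans (sum-mono-< (λ l → N≤ l (k Fin.≟ l)) j N<) N≤n))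
        where
        same : ∀ l → Dec (k ≡ l) → T p y q l ≡ T p q r l
        same l (no k≢l)   = trans (cong (λ a → t (p l) a (q l)) (y≡z l k≢l)) (t-idem (p l) (q l) (r l))
        same l (yes refl) = trans (cong (λ a → t (p l) a (q l)) (trans (cong (λ a → t (p l) a (r l)) (update-same q k)) (t-≡ refl)))
                               (t-comm (p l) (r l) (q l))

    -- The step brings the middle vertex closer to `r` and takes it away from `p`. These two
    -- distances were equal before, so they differ afterwards.
    off-odd-not-triangle : ∀ {p q r k} → Triangle S p q r → p k ≡ q k → q k ≢ r k →
                           ¬ Triangle S p (q [ k ≔ r k ]) r
    off-odd-not-triangle {p} {q} {r} {k} tri pk≡qk qk≢rk tri′ = ℕ.<-irrefl refl (begin-strict
      Δ p x ≡⟨ Triangle.Δuv≡vw tri′ ⟩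
      Δ x r <⟨ Δ-step k qk≢rk ⟩
      Δ q r ≡⟨ Triangle.Δuv≡vw tri ⟨
      Δ p q <⟨ sum-mono-< (update-elim q k (λ l a → δ (p l) (q l) ≤ δ (p l) a)
                            (≤-trans (≤-reflexive (δ-≡ pk≡qk)) z≤n) λ _ _ → ≤-refl) k
                 (subst₂ _<_ (sym (δ-≡ pk≡qk)) (sym (trans (cong (δ (p k)) (update-same q k)) (δ-≢ λ pk≡rk → qk≢rk (trans (sym pk≡qk) pk≡rk))))
                   (s≤s z≤n)) ⟩
      Δ p x ∎)
      where
      open ℕ.≤-Reasoning
      x = q [ k ≔ r k ]

    -- The step leaves the perimeter unchanged, so the induction hypothesis does not apply directly.
    -- `reduce` does, and its first alternative is excluded. The two conclusions serve different
    -- choices of the odd vertex.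
    T-off-odd : ∀ {n p q r k} → ClosedBelow n → N p q r ≤ n → Triangle S p q r →
                p k ≡ q k → q k ≢ r k → S (q [ k ≔ r k ]) →
                S (T p (q [ k ≔ r k ]) r) × S (T r (q [ k ≔ r k ]) p)
    T-off-odd {n} {p} {q} {r} {k} closed N≤n tri pk≡qk qk≢rk x∈S =
      one (reduce closed N≤ u∈S x∈S w∈S) ,
      two (reduce closed (≤-trans (≤-reflexive (N-reverse r x p)) N≤) w∈S x∈S u∈S)
      where
      open Triangle tri
      x = q [ k ≔ r k ]
      N≤ : N p x r ≤ n
      N≤ = ≤-trans (sum-mono-≤ (update-elim q k (λ l a → ν (p l) a (r l) ≤ ν (p l) (q l) (r l))
        (≤-reflexive (cong (_+ δ (r k) (p k)) (trans (cong (δ (p k) (r k) +_) (δ-≡ {x = r k} refl))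
          (trans (ℕ.+-comm (δ (p k) (r k)) 0) (cong₂ _+_ (sym (δ-≡ pk≡qk)) (cong (λ a → δ a (r k)) pk≡qk))))))
        λ _ _ → ≤-refl)) N≤n
      one : Triangle S p x r ⊎ S (T p x r) → S (T p x r)
      one (inj₁ tri′) = contradiction tri′ (off-odd-not-triangle tri pk≡qk qk≢rk)
      one (inj₂ T∈S)  = T∈S
      two : Triangle S r x p ⊎ S (T r x p) → S (T r x p)
      two (inj₁ tri′) = contradiction (triangle-rotate (triangle-flip tri′)) (off-odd-not-triangle tri pk≡qk qk≢rk)
      two (inj₂ T∈S)  = T∈S

    -- The two given points differ at `a` and `b` only. A geodesic between them changes one of these
    -- first: `a` leads to `z`, `b` to the opposite corner.
    corner : ∀ {z a b x y} → a ≢ b → z a ≢ x → z b ≢ y → S (z [ a ≔ x ]) → S (z [ b ≔ y ]) →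
             S z ⊎ S (z [ a ≔ x ] [ b ≔ y ])
    corner {z} {a} {b} {x} {y} a≢b za≢x zb≢y u∈S v∈S
      with step u∈S v∈S a (λ eq → za≢x (trans (sym (update-other z (≢-sym a≢b))) (trans (sym eq) (update-same z a))))
    ... | k , uk≢vk , s with a Fin.≟ k | b Fin.≟ k
    ... | yes refl | _ = inj₁ (resp (update-elim (z [ a ≔ x ]) a (λ i w → w ≡ z i)
            (update-other z (≢-sym a≢b)) (λ i → update-other z)) s)
    ... | no _ | yes refl = inj₂ (subst (λ w → S (z [ a ≔ x ] [ b ≔ w ])) (update-same z b) s)
    ... | no a≢k | no b≢k = contradiction (trans (update-other z a≢k) (sym (update-other z b≢k))) uk≢vk

    T-update : ∀ p q r k {x} → T p (q [ k ≔ x ]) r ≋ T p q r [ k ≔ t (p k) x (r k) ]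
    T-update p q r k {x} i = by (k Fin.≟ i)
      where
      by : Dec (k ≡ i) → T p (q [ k ≔ x ]) r i ≡ (T p q r [ k ≔ t (p k) x (r k) ]) i
      by (yes refl) = trans (cong (λ y → t (p k) y (r k)) (update-same q k)) (sym (update-same (T p q r) k))
      by (no k≢i)   = trans (cong (λ y → t (p i) y (r i)) (update-other q k≢i)) (sym (update-other (T p q r) k≢i))

    triangle-closed : ∀ {n p q r} → ClosedBelow n → N p q r ≤ n → Triangle S p q r → S (T p q r)
    triangle-closed {n} {p} {q} {r} closed N≤n tri
      with Fin.any? (λ i → q i ≟ r i ×-dec ¬? (p i ≟ q i))
    ... | no none = resp (λ i → sym (no-odd i (q i ≟ r i))) (Triangle.u∈S tri)
      where
      no-odd : ∀ i → Dec (q i ≡ r i) → T p q r i ≡ p i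
      no-odd i (yes q≡r) = t-left (decidable-stable (p i ≟ q i) λ p≢q → none (i , q≡r , p≢q))
      no-odd i (no q≢r)  = t-≢ q≢r
    ... | yes (i , qi≡ri , pi≢qi) with odd-coordinate tri qi≡ri pi≢qi
        | odd-coordinate (triangle-flip tri) (sym qi≡ri) (λ pi≡ri → pi≢qi (trans pi≡ri (sym qi≡ri)))
    ...   | j , pj≡qj , qj≢rj | l , pl≡rl , rl≢ql
      with step-to-odd closed N≤n tri qi≡ri pi≢qi pj≡qj qj≢rj
         | step-to-odd closed (≤-trans (≤-reflexive (N-flip p r q)) N≤n) (triangle-flip tri)
             (sym qi≡ri) (λ pi≡ri → pi≢qi (trans pi≡ri (sym qi≡ri))) pl≡rl rl≢ql
         | step-to-odd closed (≤-trans (≤-reflexive (N-reverse r q p)) N≤n) (triangle-rotate (triangle-flip tri)) (sym pj≡qj) (≢-sym qj≢rj) (sym qi≡ri) (≢-sym pi≢qi)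
    ... | c , pc≡qc , qc≢rc , xc∈S | b , pb≡rb , rb≢qb , xb∈S | a , ra≡qa , qa≢pa , xa∈S = conclude
      where
      z : Point
      z = T p q r
      a≢b : a ≢ b
      a≢b refl = rb≢qb ra≡qa
      b≢c : b ≢ c
      b≢c refl = rb≢qb (trans (sym pb≡rb) pc≡qc)
      a≢c : a ≢ c
      a≢c refl = qc≢rc (sym ra≡qa)
      za≢pa : z a ≢ p a
      za≢pa eq = qa≢pa (trans (sym (t-≡ (sym ra≡qa))) eq)
      zb≢qb : z b ≢ q b
      zb≢qb eq = rb≢qb (trans (sym pb≡rb) (trans (sym (t-≢ (≢-sym rb≢qb))) eq))
      zc≢rc : z c ≢ r c
      zc≢rc eq = qc≢rc (trans (sym pc≡qc) (trans (sym (t-≢ qc≢rc)) eq))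
      -- At `a`, `b`, `c` the point `z` has the majority value; each neighbour replaces it by the
      -- value of the dissenting vertex, which is `p`, `q`, `r` respectively.
      z+a : S (z [ a ≔ p a ])
      z+a = subst (λ x → S (z [ a ≔ x ])) (t-left refl)
        (resp (T-update p q r a) (proj₂ (T-off-odd closed (≤-trans (≤-reflexive (N-reverse r q p)) N≤n) (triangle-rotate (triangle-flip tri)) ra≡qa qa≢pa xa∈S)))
      z+b : S (z [ b ≔ q b ])
      z+b = subst (λ x → S (z [ b ≔ x ])) (t-≡ refl)
        (resp (update-cong b λ i → t-comm (p i) (r i) (q i)) (resp (T-update p r q b)
          (proj₁ (T-off-odd closed (≤-trans (≤-reflexive (N-flip p r q)) N≤n) (triangle-flip tri) pb≡rb rb≢qb xb∈S))))
      z+c : S (z [ c ≔ r c ])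
      z+c = subst (λ x → S (z [ c ≔ x ])) (t-≡ refl)
        (resp (T-update p q r c) (proj₁ (T-off-odd closed N≤n tri pc≡qc qc≢rc xc∈S)))
      conclude : S z
      conclude with corner a≢b za≢pa zb≢qb z+a z+b | corner b≢c zb≢qb zc≢rc z+b z+c | corner a≢c za≢pa zc≢rc z+a z+c
      ... | inj₁ z∈S | _ | _ = z∈S
      ... | inj₂ _ | inj₁ z∈S | _ = z∈S
      ... | inj₂ _ | inj₂ _ | inj₁ z∈S = z∈S
      ... | inj₂ z+ab | inj₂ z+bc | inj₂ z+ac = hexagon z a≢b b≢c a≢c za≢pa zb≢qb zc≢rc z+a z+ab z+b z+bc z+c z+ac

    closed-below : ∀ n → ClosedBelow n
    closed-below (suc n) u∈S v∈S w∈S N<n with reduce (closed-below n) (ℕ.≤-pred N<n) u∈S v∈S w∈S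
    ... | inj₁ tri = triangle-closed (closed-below n) (ℕ.≤-pred N<n) tri
    ... | inj₂ T∈S = T∈S

    T-closed : ∀ {u v w} → S u → S v → S w → S (T u v w)
    T-closed u∈S v∈S w∈S = closed-below _ u∈S v∈S w∈S ≤-refl

  -- Absorbing sets and their Helly property.

  record Absorbing (S K : Pred Point 0ℓ) : Set where
    field
      ⊆S       : ∀ {u} → K u → S u
      absorb₁₂ : ∀ {u v w} → K u → K v → S w → K (T u v w)
      absorb₁₃ : ∀ {u v w} → K u → S v → K w → K (T u v w)
      absorb₂₃ : ∀ {u v w} → S u → K v → K w → K (T u v w)

  absorbing-∩ : ∀ {S K L} → Absorbing S K → Absorbing S L → Absorbing S (K ∩ L)
  absorbing-∩ K L = record
    { ⊆S       = λ (k , _) → K.⊆S k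
    ; absorb₁₂ = λ (k , l) (k′ , l′) s → K.absorb₁₂ k k′ s , L.absorb₁₂ l l′ s
    ; absorb₁₃ = λ (k , l) s (k′ , l′) → K.absorb₁₃ k s k′ , L.absorb₁₃ l s l′
    ; absorb₂₃ = λ s (k , l) (k′ , l′) → K.absorb₂₃ s k k′ , L.absorb₂₃ s l l′
    }
    where
    module K = Absorbing K
    module L = Absorbing L

  -- Induction on `r`, intersecting `Q` with the first set. This requires triple intersections: from
  -- one point in each pairwise intersection `T` produces a point of all three sets, because each
  -- set contains two of its arguments.
  helly : ∀ {S} r {Q : Pred Point 0ℓ} (K : Fin r → Pred Point 0ℓ) →
          Absorbing S Q → (∀ i → Absorbing S (K i)) → ∃ Q →
          (∀ i j → ∃ λ u → Q u × K i u × K j u) → ∃ λ u → Q u × ∀ i → K i u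
  helly zero    K Q-abs K-abs (u , u∈Q) pairs = u , u∈Q , λ ()
  helly (suc r) {Q} K Q-abs K-abs _ pairs
    with helly r (K ∘ suc) (absorbing-∩ Q-abs (K-abs zero)) (K-abs ∘ suc)
           (let u , u∈Q , u∈K₀ , _ = pairs zero zero in u , u∈Q , u∈K₀) triples
    where
    module Q = Absorbing Q-abs
    module K i = Absorbing (K-abs i)
    triples : ∀ i j → ∃ λ u → (Q u × K zero u) × K (suc i) u × K (suc j) u
    triples i j with pairs zero (suc i) | pairs zero (suc j) | pairs (suc i) (suc j)
    ... | x , x∈Q , x∈K₀ , x∈Kᵢ | y , y∈Q , y∈K₀ , y∈Kⱼ | z , z∈Q , z∈Kᵢ , z∈Kⱼ =
      T x y z , (Q.absorb₁₂ x∈Q y∈Q (Q.⊆S z∈Q) , K.absorb₁₂ _ x∈K₀ y∈K₀ (Q.⊆S z∈Q)) ,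
      K.absorb₁₃ _ x∈Kᵢ (Q.⊆S y∈Q) z∈Kᵢ , K.absorb₂₃ _ (Q.⊆S x∈Q) y∈Kⱼ z∈Kⱼ
  ... | u , (u∈Q , u∈K₀) , u∈K = u , u∈Q , λ { zero → u∈K₀ ; (suc i) → u∈K i }

  -- From shattering to strong shattering.

  module StrongShattering {S : Pred Point 0ℓ}
    (resp : ∀ {u v} → u ≋ v → S u → S v)
    (step : ∀ {u v} → S u → S v → ∀ i → u i ≢ v i → ∃ λ k → u k ≢ v k × S (u [ k ≔ v k ]))
    (T-closed : ∀ {u v w} → S u → S v → S w → S (T u v w))
    (size : Fin m → ℕ) (ρ : ∀ i → X i → Fin (size i))
    (shattered : ∀ (β : ∀ i → Fin (size i)) → ∃ λ s → S s × ∀ i → ρ i (s i) ≡ β i)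
    (o : Point) (o∈S : S o) where

    S-absorbing : Absorbing S S
    S-absorbing = record { ⊆S = λ s → s ; absorb₁₂ = T-closed ; absorb₁₃ = T-closed ; absorb₂₃ = T-closed }

    -- Follow a geodesic from `u` towards `v` until the step that changes coordinate `i`; `q` is the
    -- point just before. The bound `n` drives the recursion.
    edge : ∀ n {u v} → Δ u v < n → S u → S v → ∀ i → u i ≢ v i →
           ∃ λ q → S q × Between u q v × q i ≡ u i × S (q [ i ≔ v i ])
    edge (suc n) {u} {v} Δ<n u∈S v∈S i ui≢vi with step u∈S v∈S i ui≢vi
    ... | k , uk≢vk , s with k Fin.≟ i
    ... | yes refl = u , u∈S , (λ _ → inj₁ refl) , refl , s
    ... | no k≢i with edge n {u [ k ≔ v k ]} {v} (ℕ.<-≤-trans (Δ-step k uk≢vk) (ℕ.≤-pred Δ<n)) s v∈S i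
                        (λ eq → ui≢vi (trans (sym (update-other u k≢i)) eq))
    ...   | q , q∈S , btw , qi≡ , q′∈S =
      q , q∈S , (λ l → between-trans (btw l) (between-step {u} {v} k l)) , trans qi≡ (update-other u k≢i) , q′∈S
      where
      between-trans : ∀ {l} {x y z w : X l} → x ≡ y ⊎ x ≡ z → y ≡ w ⊎ y ≡ z → x ≡ w ⊎ x ≡ z
      between-trans (inj₁ refl) d = d
      between-trans (inj₂ x≡z)  _ = inj₂ x≡z

    -- The clique of S through u in direction i is as large as possible.
    Full : Fin m → Pred Point 0ℓ
    Full i u = ∀ {p} → S p → S (u [ i ≔ p i ])

    -- The ends of the edge from `edge` agree except at `i`. Applying `T p` to them therefore keeps
    -- `q` off `i` and copies the value `p i` at `i`.
    full-near : ∀ {u v} → S u → S v → ∀ i → u i ≢ v i → ∃ λ q → S q × Between u q v × Full i q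
    full-near {u} {v} u∈S v∈S i ui≢vi with edge _ ≤-refl u∈S v∈S i ui≢vi
    ... | q , q∈S , btw , qi≡ui , q′∈S = q , q∈S , btw , full
      where
      full : Full i q
      full {p} p∈S = resp same (T-closed p∈S q∈S q′∈S)
        where
        same : T p q (q [ i ≔ v i ]) ≋ q [ i ≔ p i ]
        same l = by (i Fin.≟ l)
          where
          by : Dec (i ≡ l) → T p q (q [ i ≔ v i ]) l ≡ (q [ i ≔ p i ]) l
          by (yes refl) = trans (t-≢ λ eq → ui≢vi (trans (sym qi≡ui) (trans eq (update-same q i)))) (sym (update-same q i))
          by (no i≢l)   = trans (t-≡ (sym (update-other q i≢l))) (sym (update-other q i≢l))

    update-T : ∀ i {u v w u′ v′ w′ x} → (∀ l → i ≢ l → u l ≡ u′ l) → (∀ l → i ≢ l → v l ≡ v′ l) →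
               (∀ l → i ≢ l → w l ≡ w′ l) → t (u′ i) (v′ i) (w′ i) ≡ x →
               T u′ v′ w′ ≋ T u v w [ i ≔ x ]
    update-T i {u} {v} {w} {u′} {v′} {w′} {x} u≡ v≡ w≡ at l = by (i Fin.≟ l)
      where
      by : Dec (i ≡ l) → T u′ v′ w′ l ≡ (T u v w [ i ≔ x ]) l
      by (yes refl) = trans at (sym (update-same (T u v w) i))
      by (no i≢l)   = trans (sym (t-cong (u≡ l i≢l) (v≡ l i≢l) (w≡ l i≢l))) (sym (update-other (T u v w) i≢l))

    -- Since ρ i (o i) is a block, this says that direction i has at least two blocks.
    Thick : Fin m → Set
    Thick i = ∃ λ b → b ≢ ρ i (o i)

    thick? : ∀ i → Dec (Thick i)
    thick? i = Fin.any? λ b → ¬? (b Fin.≟ ρ i (o i))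

    K : Fin m → Pred Point 0ℓ
    K i u = S u × (Thick i → Full i u)

    -- Give the two arguments known to be full the value `p i` at `i`. They then agree there, so `T`
    -- yields `T u v w` with `p i` inserted.
    K-absorbing : ∀ i → Absorbing S (K i)
    K-absorbing i = record
      { ⊆S       = proj₁
      ; absorb₁₂ = λ {u} {v} {w} (u∈S , fu) (v∈S , fv) w∈S → T-closed u∈S v∈S w∈S ,
          λ th p∈S → resp (update-T i (λ _ → sym ∘ update-other u) (λ _ → sym ∘ update-other v) (λ _ _ → refl)
            (trans (t-left (trans (update-same u i) (sym (update-same v i)))) (update-same u i)))
            (T-closed (fu th p∈S) (fv th p∈S) w∈S)
      ; absorb₁₃ = λ {u} {v} {w} (u∈S , fu) v∈S (w∈S , fw) → T-closed u∈S v∈S w∈S ,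
          λ th p∈S → resp (update-T i (λ _ → sym ∘ update-other u) (λ _ _ → refl) (λ _ → sym ∘ update-other w)
            (trans (t-outer (trans (update-same u i) (sym (update-same w i)))) (update-same u i)))
            (T-closed (fu th p∈S) v∈S (fw th p∈S))
      ; absorb₂₃ = λ {u} {v} {w} u∈S (v∈S , fv) (w∈S , fw) → T-closed u∈S v∈S w∈S ,
          λ th p∈S → resp (update-T i (λ _ _ → refl) (λ _ → sym ∘ update-other v) (λ _ → sym ∘ update-other w)
            (trans (t-≡ (trans (update-same v i) (sym (update-same w i)))) (update-same v i)))
            (T-closed u∈S (fv th p∈S) (fw th p∈S))
      }

    -- In every thick direction some block misses `y i`: the block of `o i`, or another block if
    -- `y i` lies in that one. Shattering realises all these choices at once.
    avoid : (y : Point) → ∃ λ s → S s × ∀ i → Thick i → s i ≢ y i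
    avoid y =
      let s , s∈S , ρs = shattered (λ i → β i (thick? i) (ρ i (y i) Fin.≟ ρ i (o i)))
      in s , s∈S , λ i th si≡yi → β-avoids i (thick? i) (ρ i (y i) Fin.≟ ρ i (o i)) th
           (trans (sym (ρs i)) (cong (ρ i) si≡yi))
      where
      β : ∀ i → Dec (Thick i) → Dec (ρ i (y i) ≡ ρ i (o i)) → Fin (size i)
      β i (yes (b , _)) (yes _) = b
      β i _             _       = ρ i (o i)
      β-avoids : ∀ i d e → Thick i → β i d e ≢ ρ i (y i)
      β-avoids i (yes (b , b≢o)) (yes y≡o) _  b≡y = b≢o (trans b≡y y≡o)
      β-avoids i (yes _)         (no y≢o)  _  o≡y = y≢o (sym o≡y)
      β-avoids i (no thin)       _         th _   = thin th

    s⁻ : ∃ λ s → S s × ∀ i → Thick i → o i ≢ s i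
    s⁻ = let s , s∈S , s≢o = avoid o in s , s∈S , λ i th → ≢-sym (s≢o i th)

    rectangle : ∀ {i j p q} → Thick i → Thick j → i ≢ j → S p → S q → ∃ λ r → S r × r i ≡ p i × r j ≡ q j
    rectangle {i} {j} {p} {q} thᵢ thⱼ i≢j p∈S q∈S =
      let s′ , s′∈S , s′≢o    = s⁻
          u , u∈S , _ , full-u = full-near o∈S s′∈S i (s′≢o i thᵢ)
          v , v∈S , _ , full-v = full-near o∈S s′∈S j (s′≢o j thⱼ)
          s , s∈S , s≢         = avoid (v [ j ≔ u j ])
          sᵢ≢vᵢ = λ eq → s≢ i thᵢ (trans eq (sym (update-other v (≢-sym i≢j))))
          sⱼ≢uⱼ = λ eq → s≢ j thⱼ (trans eq (sym (update-same v j)))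
          eᵢ = t-≡ (sym (update-same u i))
          eⱼ = t-≢ λ eq → sⱼ≢uⱼ (trans eq (update-other u i≢j))
      -- The inner term has coordinates `s i` at `i` and `q j` at `j`. Since `s i` differs from
      -- `v i`, the outer term restores `p i`, while both its last arguments carry `q j`.
      in T p (T q s (u [ i ≔ s i ])) (v [ j ≔ q j ]) ,
         T-closed p∈S (T-closed q∈S s∈S (full-u s∈S)) (full-v q∈S) ,
         t-≢ (λ eq → sᵢ≢vᵢ (trans (sym eᵢ) (trans eq (update-other v (≢-sym i≢j))))) ,
         trans (t-≡ (trans eⱼ (sym (update-same v j)))) eⱼ

    -- `fiber` gives points full in direction `i` with two different values at `j`. Between them
    -- lies some `q` full in direction `j`; it is full in direction `i` too, since `q` is `T q u v`
    -- and `K i` is absorbing.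
    full-both : ∀ {i j} → Thick i → Thick j → i ≢ j → ∃ λ u → S u × Full i u × Full j u
    full-both {i} {j} thᵢ thⱼ i≢j =
      let s , s∈S , o≢s = s⁻
          u , u∈S , uⱼ , full-u = fiber o∈S
          v , v∈S , vⱼ , full-v = fiber s∈S
          q , q∈S , btw , full-q = full-near u∈S v∈S j λ eq → o≢s j thⱼ (trans (sym uⱼ) (trans eq vⱼ))
          _ , full-q′ = Absorbing.absorb₂₃ (K-absorbing i) q∈S (u∈S , λ _ → full-u) (v∈S , λ _ → full-v)
      in q , q∈S , (λ p∈S → resp (update-cong i (between-T btw)) (full-q′ thᵢ p∈S)) , full-q
      where
      -- `r` and `r′` share their value at `j` and differ at `i`, so the point that `full-near`
      -- finds between them keeps that value at `j`.
      fiber : ∀ {y} → S y → ∃ λ u → S u × u j ≡ y j × Full i u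
      fiber {y} y∈S =
        let s , s∈S , o≢s = s⁻
            r  , r∈S  , rᵢ  , rⱼ  = rectangle thᵢ thⱼ i≢j o∈S y∈S
            r′ , r′∈S , r′ᵢ , r′ⱼ = rectangle thᵢ thⱼ i≢j s∈S y∈S
            u , u∈S , btw , full-u = full-near r∈S r′∈S i λ eq → o≢s i thᵢ (trans (sym rᵢ) (trans eq r′ᵢ))
        in u , u∈S , reduce (btw j) rⱼ r′ⱼ , full-u
        where
        reduce : ∀ {x y z w : X j} → x ≡ y ⊎ x ≡ z → y ≡ w → z ≡ w → x ≡ w
        reduce (inj₁ refl) p _ = p
        reduce (inj₂ refl) _ p = p
      between-T : ∀ {u q v} → Between u q v → T q u v ≋ q
      between-T {u} {q} {v} btw i with u i ≟ v i | btw i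
      ... | yes _    | inj₁ q≡u = sym q≡u
      ... | yes u≡v  | inj₂ q≡v = trans u≡v (sym q≡v)
      ... | no _     | _        = refl

    full-somewhere : ∀ {i} → Thick i → ∃ λ u → S u × Full i u
    full-somewhere {i} th =
      let s , s∈S , o≢s = s⁻
          u , u∈S , _ , full-u = full-near o∈S s∈S i (o≢s i th)
      in u , u∈S , full-u

    full-everywhere : ∃ λ w → S w × ∀ i → K i w
    full-everywhere = helly m K S-absorbing K-absorbing (o , o∈S) λ i j → pair (thick? i) (thick? j) (i Fin.≟ j)
      where
      pair : ∀ {i j} → Dec (Thick i) → Dec (Thick j) → Dec (i ≡ j) → ∃ λ u → S u × K i u × K j u
      pair (no thinᵢ) (no thinⱼ) _ = o , o∈S , (o∈S , λ th → contradiction th thinᵢ) , (o∈S , λ th → contradiction th thinⱼ)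
      pair (no thinᵢ) (yes thⱼ) _ =
        let u , u∈S , full-u = full-somewhere thⱼ in u , u∈S , (u∈S , λ th → contradiction th thinᵢ) , (u∈S , λ _ → full-u)
      pair (yes thᵢ) (no thinⱼ) _ =
        let u , u∈S , full-u = full-somewhere thᵢ in u , u∈S , (u∈S , λ _ → full-u) , (u∈S , λ th → contradiction th thinⱼ)
      pair (yes thᵢ) (yes _) (yes refl) =
        let u , u∈S , full-u = full-somewhere thᵢ in u , u∈S , (u∈S , λ _ → full-u) , (u∈S , λ _ → full-u)
      pair (yes thᵢ) (yes thⱼ) (no i≢j) =
        let u , u∈S , fullᵢ , fullⱼ = full-both thᵢ thⱼ i≢j in u , u∈S , (u∈S , λ _ → fullᵢ) , (u∈S , λ _ → fullⱼ)

    Agreeing : Point → Fin m → Pred Point 0ℓ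
    Agreeing y i u = S u × u i ≡ y i

    agreeing-absorbing : ∀ y i → Absorbing S (Agreeing y i)
    agreeing-absorbing y i = record
      { ⊆S       = proj₁
      ; absorb₁₂ = λ (u∈S , u≡) (v∈S , v≡) w∈S → T-closed u∈S v∈S w∈S , trans (t-left (trans u≡ (sym v≡))) u≡
      ; absorb₁₃ = λ (u∈S , u≡) v∈S (w∈S , w≡) → T-closed u∈S v∈S w∈S , trans (t-outer (trans u≡ (sym w≡))) u≡
      ; absorb₂₃ = λ u∈S (v∈S , v≡) (w∈S , w≡) → T-closed u∈S v∈S w∈S , trans (t-≡ (trans v≡ (sym w≡))) v≡
      }

    -- By Helly, `y` is in `S` once every two of its coordinates are attained jointly. Two thick
    -- directions are handled by `rectangle`, a thick and a thin one by fullness of `w`, two thin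
    -- ones by `w` itself.
    strongly-shattered : ∃ λ (f : ∀ i → Fin (size i) → X i) → (∀ i b → ρ i (f i b) ≡ b)
      × ∀ y → (∀ i → ∃ λ b → y i ≡ f i b) → S y
    strongly-shattered with full-everywhere
    ... | w , w∈S , w∈K = (λ i → f i (thick? i)) , (λ i → section i (thick? i)) , product
      where
      sample : ∀ i (b : Fin (size i)) → ∃ λ s → S s × ∀ j → ρ j (s j) ≡ ((λ k → ρ k (o k)) [ i ≔ b ]) j
      sample i b = shattered ((λ k → ρ k (o k)) [ i ≔ b ])

      -- In a thick direction any value of `S` in the block will do; in a thin one the single block
      -- is represented by `w`.
      f : ∀ i → Dec (Thick i) → Fin (size i) → X i
      f i (yes _) b = proj₁ (sample i b) i
      f i (no _)  b = w i

      section : ∀ i d b → ρ i (f i d b) ≡ b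
      section i (yes _) b = trans (proj₂ (proj₂ (sample i b)) i) (update-same (λ k → ρ k (o k)) i)
      section i (no thin) b = trans (single (ρ i (w i))) (sym (single b))
        where
        single : ∀ c → c ≡ ρ i (o i)
        single c = decidable-stable (c Fin.≟ ρ i (o i)) λ c≢ → thin (c , c≢)

      product : ∀ y → (∀ i → ∃ λ b → y i ≡ f i (thick? i) b) → S y
      product y y≡f =
        let u , u∈S , u≡y = helly m (Agreeing y) S-absorbing (agreeing-absorbing y) (o , o∈S)
                              λ i j → pair (value i (thick? i) (y≡f i)) (value j (thick? j) (y≡f j))
        in resp (λ i → proj₂ (u≡y i)) u∈S
        where
        Value : Fin m → Set
        Value i = (Thick i × ∃ λ p → S p × p i ≡ y i) ⊎ (¬ Thick i × w i ≡ y i)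

        value : ∀ i d → (∃ λ b → y i ≡ f i d b) → Value i
        value i (yes th)  (b , y≡) = let s , s∈S , _ = sample i b in inj₁ (th , s , s∈S , sym y≡)
        value i (no thin) (b , y≡) = inj₂ (thin , sym y≡)

        mixed : ∀ {i j p} → Thick i → ¬ Thick j → S p → p i ≡ y i → w j ≡ y j →
                ∃ λ u → S u × u i ≡ y i × u j ≡ y j
        mixed {i} {j} {p} thᵢ thinⱼ p∈S p≡ w≡ =
          w [ i ≔ p i ] , proj₂ (w∈K i) thᵢ p∈S , trans (update-same w i) p≡ ,
          trans (update-other w λ i≡j → thinⱼ (subst Thick i≡j thᵢ)) w≡

        pair : ∀ {i j} → Value i → Value j → ∃ λ u → S u × Agreeing y i u × Agreeing y j u
        pair {i} {j} (inj₁ (thᵢ , p , p∈S , p≡)) (inj₁ (thⱼ , q , q∈S , q≡)) with i Fin.≟ j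
        ... | yes refl = p , p∈S , (p∈S , p≡) , (p∈S , p≡)
        ... | no i≢j   = let u , u∈S , u≡p , u≡q = rectangle thᵢ thⱼ i≢j p∈S q∈S in
                         u , u∈S , (u∈S , trans u≡p p≡) , (u∈S , trans u≡q q≡)
        pair (inj₁ (thᵢ , p , p∈S , p≡)) (inj₂ (thinⱼ , w≡)) =
          let u , u∈S , uᵢ , uⱼ = mixed thᵢ thinⱼ p∈S p≡ w≡ in u , u∈S , (u∈S , uᵢ) , (u∈S , uⱼ)
        pair (inj₂ (thinᵢ , w≡)) (inj₁ (thⱼ , q , q∈S , q≡)) =
          let u , u∈S , uⱼ , uᵢ = mixed thⱼ thinᵢ q∈S q≡ w≡ in u , u∈S , (u∈S , uᵢ) , (u∈S , uⱼ)
        pair (inj₂ (_ , wᵢ≡)) (inj₂ (_ , wⱼ≡)) = w , w∈S , (w∈S , wᵢ≡) , (w∈S , wⱼ≡)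

-- Graph distance and Hamming distance.

module _ (G : Graph) where

  open Graph G hiding (Vertex)

  d-walk : ∀ u v → Walk _~_ (d u v) u v
  d-walk u v = proj₁ (proj₂ (shortest u v))

  d-least : ∀ {k u v} → Walk _~_ k u v → d u v ≤ k
  d-least p = proj₂ (proj₂ (shortest _ _)) p

  ~⇒d≤1 : ∀ {u v} → u ~ v → d u v ≤ 1
  ~⇒d≤1 e = d-least (e ∷ [])

  d≡1⇒~ : ∀ u v → d u v ≡ 1 → u ~ v
  d≡1⇒~ u v eq with subst (λ k → Walk _~_ k u v) eq (d-walk u v)
  ... | e ∷ [] = e

  d≡0⇒≡ : ∀ u v → d u v ≡ 0 → u ≡ v
  d≡0⇒≡ u v eq with subst (λ k → Walk _~_ k u v) eq (d-walk u v)
  ... | [] = refl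

  d-self : ∀ {u v} → u ≡ v → d u v ≡ 0
  d-self refl = ℕ.n≤0⇒n≡0 (d-least [])

module HammingPoints {m} (n : Vec ℕ m) = Points {X = λ i → Fin (lookup n i)} Fin._≟_

!-ext : ∀ {m} {n : Vec ℕ m} {u v : Tuple n} → (∀ i → u ! i ≡ v ! i) → u ≡ v
!-ext {u = []}    {[]}    eq = refl
!-ext {u = x ∷ u} {y ∷ v} eq = cong₂ _∷_ (eq zero) (!-ext (eq ∘ suc))

!-lookup⁻ : ∀ {m} {n : Vec ℕ m} (f : ∀ i → Fin (lookup n i)) i → lookup⁻ {xs = n} f ! i ≡ f i
!-lookup⁻ {n = _ ∷ _} f zero    = refl
!-lookup⁻ {n = _ ∷ n} f (suc i) = !-lookup⁻ {n = n} (f ∘ suc) i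

module _ {m} {n : Vec ℕ m} where

  open HammingPoints n using (Δ; Δ-refl; Δ-triangle; Δ-single; δ≤1)

  ~ₕ⇒Δ≤1 : ∀ (u v : Tuple n) → u ~ₕ v → Δ (u !_) (v !_) ≤ 1
  ~ₕ⇒Δ≤1 u v (k , _ , unique) =
    ≤-trans (≤-reflexive (Δ-single k λ i k≢i → decidable-stable (u ! i Fin.≟ v ! i) (k≢i ∘ unique))) (δ≤1 (u ! k) (v ! k))

  walk⇒Δ≤ : ∀ {k} {u v : Tuple n} → Walk _~ₕ_ k u v → Δ (u !_) (v !_) ≤ k
  walk⇒Δ≤ {u = u} []                      = ≤-reflexive (Δ-refl (u !_))
  walk⇒Δ≤ {u = u} {v} (_∷_ {v = q} e p) =
    ≤-trans (Δ-triangle (u !_) (q !_) (v !_)) (ℕ.+-mono-≤ (~ₕ⇒Δ≤1 u q e) (walk⇒Δ≤ p))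

Δ-walk : ∀ {m} {n : Vec ℕ m} (u v : Tuple n) → Walk _~ₕ_ (HammingPoints.Δ n (u !_) (v !_)) u v
Δ-walk []      []      = []
Δ-walk (x ∷ u) (y ∷ v) with x Fin.≟ y
... | yes refl = walk-tail x (Δ-walk u v)
... | no x≢y   = ~ₕ-head u x≢y ∷ walk-tail y (Δ-walk u v)

d≡Δ : ∀ {m} (n : Vec ℕ m) (u v : Tuple n) → Graph.d (Hamming n) u v ≡ HammingPoints.Δ n (u !_) (v !_)
d≡Δ n u v = ℕ.≤-antisym (d-least (Hamming n) (Δ-walk u v)) (walk⇒Δ≤ (d-walk (Hamming n) u v))

-- In the 3-cube the dual discriminator is the majority operation.
Q₃-median : ∀ (x y z : Vertex Q₃) → Graph.d Q₃ x y ≡ 2 → Graph.d Q₃ y z ≡ 2 → Graph.d Q₃ x z ≡ 2 →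
            ∃ λ e → Graph._~_ Q₃ e x × Graph._~_ Q₃ e y × Graph._~_ Q₃ e z
Q₃-median x y z xy yz xz =
  e , d≡1⇒~ Q₃ e x (trans (d-sym e x) xe≡1) , d≡1⇒~ Q₃ e y (trans (d-sym e y) ye≡1) , d≡1⇒~ Q₃ e z (trans (d-sym e z) ze≡1)
  where
  n = 2 ∷ 2 ∷ 2 ∷ []
  open HammingPoints n using (T; T-betweenˡ; T-betweenʳ; Between; between-Δ; Δ-sym)
  open Graph Q₃ using (d)
  d-sym : ∀ u v → d u v ≡ d v u
  d-sym u v = trans (d≡Δ n u v) (trans (Δ-sym (u !_) (v !_)) (sym (d≡Δ n v u)))
  e : Vertex Q₃
  e = lookup⁻ (T (x !_) (y !_) (z !_))
  -- With two values, `t` is also between its last two arguments: if these differ, they are all the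
  -- values there are.
  Fin2-between : ∀ a b c → Discrete.t {Fin 2} Fin._≟_ a b c ≡ b ⊎ Discrete.t {Fin 2} Fin._≟_ a b c ≡ c
  Fin2-between 0F 0F c  = Discrete.t-betweenʳ Fin._≟_ 0F 0F c
  Fin2-between 0F 1F 0F = inj₂ refl
  Fin2-between 0F 1F 1F = inj₁ refl
  Fin2-between 1F 0F 0F = inj₁ refl
  Fin2-between 1F 0F 1F = inj₂ refl
  Fin2-between 1F 1F c  = Discrete.t-betweenʳ Fin._≟_ 1F 1F c
  T-between : Between (y !_) (T (x !_) (y !_) (z !_)) (z !_)
  T-between 0F = Fin2-between _ (y ! 0F) (z ! 0F)
  T-between 1F = Fin2-between _ (y ! 1F) (z ! 1F)
  T-between 2F = Fin2-between _ (y ! 2F) (z ! 2F)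
  through-e : ∀ u v → Between (u !_) (T (x !_) (y !_) (z !_)) (v !_) → d u v ≡ 2 → d u e + d v e ≡ 2
  through-e u v btw uv≡2 = trans (cong₂ _+_ (d≡Δ n u e) (trans (d-sym v e) (d≡Δ n e v)))
    (trans (between-Δ λ i → subst (λ a → a ≡ u ! i ⊎ a ≡ v ! i) (sym (!-lookup⁻ {n = n} (T (x !_) (y !_) (z !_)) i)) (btw i))
      (trans (sym (d≡Δ n u v)) uv≡2))
  halve : ∀ {a b c} → a + b ≡ 2 → b + c ≡ 2 → a + c ≡ 2 → a ≡ 1 × b ≡ 1 × c ≡ 1
  halve {0} refl refl ()
  halve {1} refl refl _ = refl , refl , refl
  halve {2} {0} refl refl ()
  ones : d x e ≡ 1 × d y e ≡ 1 × d z e ≡ 1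
  ones = halve (through-e x y (T-betweenˡ (x !_) (y !_) (z !_)) xy) (through-e y z T-between yz)
               (through-e x z (T-betweenʳ (x !_) (y !_) (z !_)) xz)
  xe≡1 = proj₁ ones
  ye≡1 = proj₁ (proj₂ ones)
  ze≡1 = proj₂ (proj₂ ones)

diff : Bool → Bool → ℕ
diff true  true  = 0
diff true  false = 1
diff false true  = 1
diff false false = 0

-- A 6-cycle in the 3-cube: all corners but 000 and 111.
hexagon-corner : Fin 6 → Bool × Bool × Bool
hexagon-corner 0F = true  , false , false
hexagon-corner 1F = true  , true  , false
hexagon-corner 2F = false , true  , false
hexagon-corner 3F = false , true  , true
hexagon-corner 4F = false , false , true
hexagon-corner 5F = true  , false , true

corner-distance : Bool × Bool × Bool → Bool × Bool × Bool → ℕ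
corner-distance (s , t , r) (s′ , t′ , r′) = diff s s′ + diff t t′ + diff r r′

hexagon-distance : ∀ i j → corner-distance (hexagon-corner i) (hexagon-corner j) ≡ Graph.d C₆ i j
hexagon-distance = from-yes (Fin.all? λ i → Fin.all? λ j →
  corner-distance (hexagon-corner i) (hexagon-corner j) ℕ.≟ Graph.d C₆ i j)

-- The image of an isometrically embedded quasi-median graph.

module IsometricImage {m : ℕ} (n : Vec ℕ m) (G : Graph) (φ : Vertex G → Tuple n)
                      (φ-isometric : Isometric G (Hamming n) φ) where

  open HammingPoints n
  open Graph G hiding (Vertex)

  point : Vertex G → Point
  point v i = φ v ! i

  S : Pred Point 0ℓ
  S u = ∃ λ v → point v ≋ u

  d≡Δφ : ∀ u v → d u v ≡ Δ (point u) (point v)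
  d≡Δφ u v = trans (sym (φ-isometric u v)) (d≡Δ n (φ u) (φ v))

  S-resp : ∀ {u v} → u ≋ v → S u → S v
  S-resp u≋v (g , g≋u) = g , λ i → trans (g≋u i) (u≋v i)

  -- Isometry makes the first edge of a shortest walk change exactly one coordinate and stay between
  -- the endpoints, so the new value is that of `h`.
  first-step : ∀ {k g h} i → Walk _~_ k g h → k ≡ d g h → point g i ≢ point h i →
               ∃ λ j → point g j ≢ point h j × S (point g [ j ≔ point h j ])
  first-step i [] _ gᵢ≢hᵢ = contradiction refl gᵢ≢hᵢ
  first-step {suc k} {g} {h} i (_∷_ {v = w} e p) shortest gᵢ≢hᵢ
    with Fin.any? (λ j → ¬? (point g j Fin.≟ point w j))
  ... | no none = contradiction (≤-trans (≤-reflexive (trans shortest (trans (d≡Δφ g h)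
          (trans (Δ-cong (λ j → decidable-stable (point g j Fin.≟ point w j) λ ≢ → none (j , ≢)) λ _ → refl)
            (sym (d≡Δφ w h)))))) (d-least G p)) (ℕ.<-irrefl refl)
  ... | yes (j , gⱼ≢wⱼ) = j , (λ gⱼ≡hⱼ → gⱼ≢wⱼ (trans gⱼ≡hⱼ (sym wⱼ≡hⱼ))) , w , ≋-sym
          (update-elim (point g) j (λ l a → a ≡ point w l) (sym wⱼ≡hⱼ) λ l j≢l →
            decidable-stable (point g l Fin.≟ point w l) λ gₗ≢wₗ → j≢l (Δ≤1-unique gw≤1 gⱼ≢wⱼ gₗ≢wₗ))
    where
    gw≤1 : Δ (point g) (point w) ≤ 1
    gw≤1 = ≤-trans (≤-reflexive (sym (d≡Δφ g w))) (~⇒d≤1 G e)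
    btw : Between (point g) (point w) (point h)
    btw = Δ-between (ℕ.≤-antisym
      (≤-trans (ℕ.+-mono-≤ gw≤1 (≤-trans (≤-reflexive (sym (d≡Δφ w h))) (d-least G p)))
               (≤-reflexive (trans shortest (d≡Δφ g h))))
      (Δ-triangle (point g) (point w) (point h)))
    wⱼ≡hⱼ : point w j ≡ point h j
    wⱼ≡hⱼ with btw j
    ... | inj₁ wⱼ≡gⱼ = contradiction (sym wⱼ≡gⱼ) gⱼ≢wⱼ
    ... | inj₂ eq    = eq

  S-step : ∀ {u v} → S u → S v → ∀ i → u i ≢ v i → ∃ λ k → u k ≢ v k × S (u [ k ≔ v k ])
  S-step {u} {v} (g , g≋u) (h , h≋v) i uᵢ≢vᵢ =
    let k , gₖ≢hₖ , s = first-step i (d-walk G g h) refl (λ eq → uᵢ≢vᵢ (trans (sym (g≋u i)) (trans eq (h≋v i))))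
    in k , (λ eq → gₖ≢hₖ (trans (g≋u k) (trans eq (sym (h≋v k))))) ,
       subst (λ a → S (u [ k ≔ a ])) (h≋v k) (S-resp (update-cong k g≋u) s)

  between⇒interval : ∀ {u x v} → Between (point u) (point x) (point v) → [ u , v ] x
  between⇒interval {u} {x} {v} btw =
    trans (cong₂ _+_ (d≡Δφ u x) (d≡Δφ x v)) (trans (between-Δ btw) (sym (d≡Δφ u v)))

  -- If `p` differs from `z` at `j`, this is its only difference from `z [ b ≔ y ]`, so `p b` is
  -- `y`. Then `p` differs from `z [ c ≔ w ]` at both `b` and `j`.
  near-two : ∀ (z p : Point) {b c y w j} → b ≢ c → b ≢ j → c ≢ j → z b ≢ y →
             Δ p (z [ b ≔ y ]) ≤ 1 → Δ p (z [ c ≔ w ]) ≤ 1 → p j ≡ z j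
  near-two z p {b} {c} {y} {w} {j} b≢c b≢j c≢j zb≢y Δb Δc = decidable-stable (p j Fin.≟ z j) λ pⱼ≢zⱼ →
    let pb≡y = decidable-stable (p b Fin.≟ y) λ pb≢y →
                 b≢j (Δ≤1-unique Δb (λ eq → pb≢y (trans eq (update-same z b)))
                                    (λ eq → pⱼ≢zⱼ (trans eq (update-other z b≢j))))
    in b≢j (Δ≤1-unique Δc (λ eq → zb≢y (trans (sym (update-other z (≢-sym b≢c))) (trans (sym eq) pb≡y)))
                          (λ eq → pⱼ≢zⱼ (trans eq (update-other z c≢j))))

  module _ (G-quasi-median : IsQuasiMedian G) where

    open IsQuasiMedian G-quasi-median

    S-quasi-median : ∀ {u v w} → S u → S v → S w → ∃ λ a → ∃ λ b → ∃ λ c → Triangle S a b c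
      × Δ u v ≡ Δ u a + Δ a b + Δ b v
      × Δ v w ≡ Δ v b + Δ b c + Δ c w
      × Δ w u ≡ Δ w c + Δ c a + Δ a u
    S-quasi-median {u} {v} {w} (g , g≋u) (h , h≋v) (l , l≋w) with unique-quasi-median (g F.∷ h F.∷ l F.∷ F.[])
    ... | q , (triangle , dist) , _ = point (q 0F) , point (q 1F) , point (q 2F) , record
          { u∈S = q 0F , λ _ → refl ; v∈S = q 1F , λ _ → refl ; w∈S = q 2F , λ _ → refl
          ; apex-u = apex 0F 1F 2F (λ ()) (λ ()) (λ ())
          ; apex-v = apex 1F 2F 0F (λ ()) (λ ()) (λ ())
          ; apex-w = apex 2F 0F 1F (λ ()) (λ ()) (λ ())
          ; Δuv≡vw = side (proj₁ equi)
          ; Δvw≡wu = side (proj₂ equi)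
          }
          , path g≋u h≋v (dist 0F 1F (λ ())) , path h≋v l≋w (dist 1F 2F (λ ())) , path l≋w g≋u (dist 2F 0F (λ ()))
      where
      equi : Equilateral q
      equi = equilateral _ q (triangle , dist)
      apex : ∀ i j k → i ≢ j → i ≢ k → j ≢ k → ∀ {x} → S x →
             Between (point (q i)) x (point (q j)) → Between (point (q i)) x (point (q k)) → x ≋ point (q i)
      apex i j k i≢j i≢k j≢k {x} (f , f≋x) p r a =
        trans (sym (f≋x a)) (cong (λ v → point v a) (sym (proj₁ (triangle i j k i≢j i≢k j≢k) (interval p , interval r))))
        where
        interval : ∀ {v} → Between (point (q i)) x (point v) → [ q i , v ] f
        interval btw = between⇒interval λ b → map (trans (f≋x b)) (trans (f≋x b)) (btw b)
      side : ∀ {a b c e} → d a b ≡ d c e → Δ (point a) (point b) ≡ Δ (point c) (point e)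
      side {a} {b} {c} {e} eq = trans (sym (d≡Δφ a b)) (trans eq (d≡Δφ c e))
      path : ∀ {a b e f x y} → point a ≋ x → point b ≋ y → d a b ≡ d a e + d e f + d f b →
             Δ x y ≡ Δ x (point e) + Δ (point e) (point f) + Δ (point f) y
      path {a} {b} {e} {f} a≋x b≋y eq =
        trans (sym (Δ-cong a≋x b≋y)) (trans (sym (d≡Δφ a b)) (trans eq (cong₂ _+_ (cong₂ _+_
          (trans (d≡Δφ a e) (Δ-cong {v = point e} a≋x λ _ → refl)) (d≡Δφ e f)) (trans (d≡Δφ f b) (Δ-cong {u = point f} (λ _ → refl) b≋y)))))

    -- The convex hull of the hexagon is a 3-cube; the alternate vertices of the
    -- hexagon have pairwise distance 2 in it, hence a common neighbour.
    hexagon-centre : ∀ (c : Vertex C₆ → Vertex G) → Isometric C₆ G c →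
                     ∃ λ v → v ~ c 0F × v ~ c 2F × v ~ c 4F
    hexagon-centre c c-isometric =
      let e , e~w₀ , e~w₂ , e~w₄ = Q₃-median (w 0F) (w 2F) (w 4F) (two-apart 0F 1F 2F refl refl refl) (two-apart 2F 3F 4F refl refl refl)
                                             (two-apart 0F 5F 4F refl refl refl)
      in q e , adjacent 0F e~w₀ , adjacent 2F e~w₂ , adjacent 4F e~w₄
      where
      hull = hull-of-6-cycle c c-isometric
      q : Vertex Q₃ → Vertex G
      q = proj₁ hull
      preserves : ∀ x y → Graph._~_ Q₃ x y → q x ~ q y
      preserves x y = Equivalence.to (proj₂ (proj₁ (proj₂ hull)) x y)
      reflects : ∀ x y → q x ~ q y → Graph._~_ Q₃ x y
      reflects x y = Equivalence.from (proj₂ (proj₁ (proj₂ hull)) x y)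
      preimage : ∀ i → Image q (c i)
      preimage i = proj₂ (proj₂ (proj₂ hull)) (λ P _ c⊆P → c⊆P (i , refl))
      w : Fin 6 → Vertex Q₃
      w i = proj₁ (preimage i)
      qw≡c : ∀ i → q (w i) ≡ c i
      qw≡c i = proj₂ (preimage i)
      adjacent : ∀ i {e} → Graph._~_ Q₃ e (w i) → q e ~ c i
      adjacent i e~w = subst (q _ ~_) (qw≡c i) (preserves _ _ e~w)
      lift : ∀ i j → Graph.d C₆ i j ≡ 1 → Graph._~_ Q₃ (w i) (w j)
      lift i j ij≡1 = reflects (w i) (w j) (subst₂ _~_ (sym (qw≡c i)) (sym (qw≡c j))
        (d≡1⇒~ G (c i) (c j) (trans (c-isometric i j) ij≡1)))
      -- `q` is given as induced, not as isometric. The walk through `w k` bounds the distance by 2;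
      -- distance 0 or 1 would make `c i` and `c j` equal or adjacent.
      two-apart : ∀ i k j → Graph.d C₆ i k ≡ 1 → Graph.d C₆ k j ≡ 1 → Graph.d C₆ i j ≡ 2 → Graph.d Q₃ (w i) (w j) ≡ 2
      two-apart i k j ik≡1 kj≡1 ij≡2 = ℕ.≤-antisym (d-least Q₃ {u = w i} {w j} (_∷_ {v = w k} (lift i k ik≡1) (_∷_ {v = w j} (lift k j kj≡1) [])))
        (ℕ.≤∧≢⇒< (ℕ.n≢0⇒n>0 λ d≡0 → contradiction (trans (sym (cᵢcⱼ≡2)) (d-self G
            (trans (sym (qw≡c i)) (trans (cong q (d≡0⇒≡ Q₃ (w i) (w j) d≡0)) (qw≡c j))))) λ ())
          λ 1≡d → ℕ.<⇒≱ (s≤s (s≤s z≤n)) (≤-trans (≤-reflexive (sym cᵢcⱼ≡2)) (~⇒d≤1 G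
            (subst (_~ c j) (qw≡c i) (adjacent j (d≡1⇒~ Q₃ (w i) (w j) (sym 1≡d)))))))
        where
        cᵢcⱼ≡2 : d (c i) (c j) ≡ 2
        cᵢcⱼ≡2 = trans (c-isometric i j) ij≡2

    -- The centre of the hexagon is within distance 1 of three points that differ from `z` in one
    -- coordinate each; `near-two` forces it to have the coordinates of `z`.
    S-hexagon : ∀ z {a b c x y w} → a ≢ b → b ≢ c → a ≢ c → z a ≢ x → z b ≢ y → z c ≢ w →
      S (z [ a ≔ x ]) → S (z [ a ≔ x ] [ b ≔ y ]) → S (z [ b ≔ y ]) →
      S (z [ b ≔ y ] [ c ≔ w ]) → S (z [ c ≔ w ]) → S (z [ a ≔ x ] [ c ≔ w ]) → S z
    S-hexagon z {a} {b} {c} {x} {y} {w} a≢b b≢c a≢c za≢x zb≢y zc≢w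
              (g₀ , g₀≋) (g₁ , g₁≋) (g₂ , g₂≋) (g₃ , g₃≋) (g₄ , g₄≋) (g₅ , g₅≋) =
      let v , v~g₀ , v~g₂ , v~g₄ = hexagon-centre hexagon hexagon-isometric
      in v , λ j → at-centre (point v) (near v~g₀ g₀≋) (near v~g₂ g₂≋) (near v~g₄ g₄≋) j (a Fin.≟ j) (b Fin.≟ j)
      where
      -- All three coordinates are written, also unchanged ones, so that `Δ-update` computes every
      -- distance in the same way.
      cube : Bool × Bool × Bool → Point
      cube (s , t , r) = z [ a ≔ if s then x else z a ] [ b ≔ if t then y else z b ] [ c ≔ if r then w else z c ]

      diff-δ : ∀ {i} {p q : Fin (lookup n i)} → p ≢ q → ∀ s s′ → δ {i} (if s then q else p) (if s′ then q else p) ≡ diff s s′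
      diff-δ {q = q} p≢q true  true  = δ-≡ {x = q} refl
      diff-δ p≢q true  false = δ-≢ (≢-sym p≢q)
      diff-δ p≢q false true  = δ-≢ p≢q
      diff-δ {p = p} p≢q false false = δ-≡ {x = p} refl

      Δ-cube : ∀ p q → Δ (cube p) (cube q) ≡ corner-distance p q
      Δ-cube (s , t , r) (s′ , t′ , r′) = trans
        (Δ-update (trans (update-other _ b≢c) (trans (update-other z a≢c) (sym (trans (update-other _ b≢c) (update-other z a≢c))))))
        (cong₂ _+_ (trans (Δ-update (trans (update-other z a≢b) (sym (update-other z a≢b))))
          (cong₂ _+_ (trans (Δ-update {z} {z} refl) (cong₂ _+_ (Δ-refl z) (diff-δ za≢x s s′))) (diff-δ zb≢y t t′))) (diff-δ zc≢w r r′))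

      hexagon : Vertex C₆ → Vertex G
      hexagon 0F = g₀
      hexagon 1F = g₁
      hexagon 2F = g₂
      hexagon 3F = g₃
      hexagon 4F = g₄
      hexagon 5F = g₅

      update-id : ∀ (u : Point) k {p} → p ≡ u k → u [ k ≔ p ] ≋ u
      update-id u k p≡ = update-elim u k (λ i q → q ≡ u i) p≡ λ _ _ → refl

      za≡ : z [ a ≔ z a ] ≋ z
      za≡ = update-id z a refl
      zb≡ : ∀ {p} → z [ a ≔ p ] [ b ≔ z b ] ≋ z [ a ≔ p ]
      zb≡ = update-id _ b (sym (update-other z a≢b))
      zc≡ : ∀ {p q} → z [ a ≔ p ] [ b ≔ q ] [ c ≔ z c ] ≋ z [ a ≔ p ] [ b ≔ q ]
      zc≡ = update-id _ c (sym (trans (update-other _ b≢c) (update-other z a≢c)))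

      cube≋hexagon : ∀ i → cube (hexagon-corner i) ≋ point (hexagon i)
      cube≋hexagon 0F i = trans (zc≡ i) (trans (zb≡ i) (sym (g₀≋ i)))
      cube≋hexagon 1F i = trans (zc≡ i) (sym (g₁≋ i))
      cube≋hexagon 2F i = trans (zc≡ i) (trans (update-cong b za≡ i) (sym (g₂≋ i)))
      cube≋hexagon 3F i = trans (update-cong c (update-cong b za≡) i) (sym (g₃≋ i))
      cube≋hexagon 4F i = trans (update-cong c zb≡ i) (trans (update-cong c za≡ i) (sym (g₄≋ i)))
      cube≋hexagon 5F i = trans (update-cong c zb≡ i) (sym (g₅≋ i))

      hexagon-isometric : Isometric C₆ G hexagon
      hexagon-isometric i j = trans (d≡Δφ (hexagon i) (hexagon j))
        (trans (sym (Δ-cong (cube≋hexagon i) (cube≋hexagon j)))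
          (trans (Δ-cube (hexagon-corner i) (hexagon-corner j)) (hexagon-distance i j)))

      near : ∀ {v g u} → v ~ g → point g ≋ u → Δ (point v) u ≤ 1
      near {v} {g} v~g g≋u = ≤-trans (≤-reflexive (trans (sym (Δ-cong {point v} (λ _ → refl) g≋u)) (sym (d≡Δφ v g)))) (~⇒d≤1 G v~g)

      at-centre : ∀ p → Δ p (z [ a ≔ x ]) ≤ 1 → Δ p (z [ b ≔ y ]) ≤ 1 → Δ p (z [ c ≔ w ]) ≤ 1 →
                  ∀ j → Dec (a ≡ j) → Dec (b ≡ j) → p j ≡ z j
      at-centre p Δa Δb Δc j (yes refl) _          = near-two z p b≢c (≢-sym a≢b) (≢-sym a≢c) zb≢y Δb Δc
      at-centre p Δa Δb Δc j (no a≢j)   (yes refl) = near-two z p a≢c a≢b (≢-sym b≢c) za≢x Δa Δc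
      at-centre p Δa Δb Δc j (no a≢j)   (no b≢j)   = near-two z p a≢b a≢j b≢j za≢x Δa Δb

    S-isQuasiMedianSet : IsQuasiMedianSet S
    S-isQuasiMedianSet = record
      { resp = S-resp ; step = S-step ; quasi-median = S-quasi-median ; hexagon = S-hexagon }

-- Transversals and the ampleness of the image.

module _ {k : ℕ} {P : Pred (Fin k) 0ℓ} (P? : ∀ x → Dec (P x)) where

  comprehension : Subset k
  comprehension = tabulate (does ∘ P?)

  ∈-comprehension⁺ : ∀ {x} → P x → x ∈ₛ comprehension
  ∈-comprehension⁺ {x} p = lookup⇒[]= x _ (trans (lookup∘tabulate _ x) (dec-true (P? x) p))

  ∈-comprehension⁻ : ∀ {x} → x ∈ₛ comprehension → P x
  ∈-comprehension⁻ {x} x∈ with P? x | trans (sym (lookup∘tabulate (does ∘ P?) x)) ([]=⇒lookup x∈)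
  ... | yes p | _ = p

proposition5 : ∀ {m} (n : Vec ℕ m) → All NonZero n →
    (G : Graph) → IsQuasiMedian G →
    (φ : Graph.Vertex G → Tuple n) → Isometric G (Hamming n) φ →
    Ample (Image φ)
proposition5 n n≢0 G G-quasi-median φ φ-isometric Λ shattered =
  W , transversal , λ {u} u∈W →
    let v , v≋u = product (u !_) (λ i → ρ i (u ! i) , ∈-comprehension⁻ (selected? i) (u∈W i))
    in v , !-ext v≋u
  where
  open Partition
  open IsometricImage n G φ φ-isometric
  open HammingPoints n using (Point; module Closure; module StrongShattering)

  ρ : ∀ i → Fin (lookup n i) → Fin (size (Λ i))
  ρ i x = proj₁ (covers (Λ i) x)

  ∈-block : ∀ i x → x ∈ₛ block (Λ i) (ρ i x)
  ∈-block i x = proj₁ (proj₂ (covers (Λ i) x))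

  ρ-unique : ∀ i {x b} → x ∈ₛ block (Λ i) b → ρ i x ≡ b
  ρ-unique i {x} = proj₂ (proj₂ (covers (Λ i) x))

  meets : ∀ β → ∃ λ s → S s × ∀ i → ρ i (s i) ≡ β i
  meets β = let u , (v , φv≡u) , u∈box = shattered β in
    (u !_) , (v , λ i → cong (_! i) φv≡u) , λ i → ρ-unique i (u∈box i)

  -- As no factor is empty, each has a block to choose; shattering then supplies the base point.
  point-of-S : ∃ S
  point-of-S = let s , s∈S , _ = meets λ i → ρ i (fromℕ< (>-nonZero⁻¹ (lookup n i) {{lookup⁺ n≢0 i}})) in s , s∈S

  strong = StrongShattering.strongly-shattered S-resp S-step
    (Closure.T-closed (S-isQuasiMedianSet G-quasi-median))
    (size ∘ Λ) ρ meets (proj₁ point-of-S) (proj₂ point-of-S)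

  f : ∀ i → Fin (size (Λ i)) → Fin (lookup n i)
  f = proj₁ strong

  ρf≡ : ∀ i b → ρ i (f i b) ≡ b
  ρf≡ = proj₁ (proj₂ strong)

  product : ∀ y → (∀ i → ∃ λ b → y i ≡ f i b) → S y
  product = proj₂ (proj₂ strong)

  -- `f i` is a section of `ρ i`, so its range consists of the values fixed by `f i ∘ ρ i`; this
  -- makes membership in the range decidable.
  selected? : ∀ i x → Dec (x ≡ f i (ρ i x))
  selected? i x = x Fin.≟ f i (ρ i x)

  W : ∀ i → Subset (lookup n i)
  W i = comprehension (selected? i)

  transversal : IsTransversal {n = n} Λ W
  transversal i b = f i b ,
    (∈-comprehension⁺ (selected? i) (cong (f i) (sym (ρf≡ i b))) ,
     subst (λ c → f i b ∈ₛ block (Λ i) c) (ρf≡ i b) (∈-block i (f i b))) ,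
    λ (x∈W , x∈b) → sym (trans (∈-comprehension⁻ (selected? i) x∈W) (cong (f i) (ρ-unique i x∈b)))
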